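{- Let $\kappa$ be an infinite cardinal, and let $\mathcal{L}\subseteq\mathrm{Scat}_\kappa$ be nonempty and downward $\preceq$-closed and such that $\trianglelefteq^{\mathcal{L}}_\kappa$ is transitive. Then $(\mathrm{LO}_\kappa,\trianglelefteq^{\mathcal{L}}_\kappa)$ has the fractal property with respect to its upper cones, that is, for every $L_0\in\mathrm{LO}_\kappa$, $(\mathrm{LO}_\kappa,\trianglelefteq^{\mathcal{L}}_\kappa)$ embeds into $(L_0{\uparrow^{\mathcal{L}}},\trianglelefteq^{\mathcal{L}}_\kappa)$, where $L_0{\uparrow^{\mathcal{L}}}=\{L\in\mathrm{LO}_\kappa: L_0\trianglelefteq^{\mathcal{L}}_\kappa L\}$.
   Context: Linear orders are reflexive and nonempty; $L\preceq L'$ means there is an embedding $f:L\to L'$, i.e. $x\le_L y\iff f(x)\le_{L'}f(y)$. For a cardinal $\kappa$, $\mathrm{LO}_\kappa$ is the set of (codes for) linear orders with domain $\kappa$, $\mathrm{Lin}_\kappa=\bigcup_{0<\lambda\le\kappa}\mathrm{LO}_\lambda$ ($\lambda$ ranging over cardinals), i.e. the nonempty linear orders of size at most $\kappa$, and $\mathrm{Scat}_\kappa\subseteq\mathrm{Lin}_\kappa$ consists of the scattered ones (those $L$ with $\mathbb{Q}\not\preceq L$). $\mathcal{L}\subseteq\mathrm{Lin}_\kappa$ is downward $\preceq$-closed if $K\in\mathrm{Lin}_\kappa$, $K\preceq L\in\mathcal{L}$ imply $K\in\mathcal{L}$; membership is meant up to isomorphism. A subset $I$ of $L$ is convex if $x\le_L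 y\le_L z$ and $x,z\in I$ imply $y\in I$. A $K$-convex partition of $L$ is a partition $(L_k)_{k\in K}$ of $L$ (into nonempty sets) such that $k<_K k'\iff$ every element of $L_k$ is $<_L$ every element of $L_{k'}$. $L\trianglelefteq^{\mathcal{L}}L'$ iff there are $K\in\mathcal{L}$, a $K$-convex partition $(L_k)_{k\in K}$ of $L$, and an embedding $f$ of $L$ into $L'$ such that each $f(L_k)$ is a convex subset of $L'$. $\trianglelefteq^{\mathcal{L}}_\kappa$ is the restriction of $\trianglelefteq^{\mathcal{L}}$ to $\mathrm{LO}_\kappa$. A quasi-order $(X,\precsim)$ embeds into $(Y,\precsim')$ if there is $\varphi:X\to Y$ with $x\precsim x'\iff\varphi(x)\precsim'\varphi(x')$. -}

module Defs where

open import Axiom.ExcludedMiddle using (ExcludedMiddle)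
open import Data.Nat.Base using (ℕ)
open import Data.Product.Base using (Σ-syntax; ∃-syntax; _×_; proj₁)
open import Data.Rational.Base using (ℚ) renaming (_≤_ to _≤ℚ_)
open import Data.Rational.Properties using () renaming (≤-isTotalOrder to ≤ℚ-isTotalOrder)
open import Function.Base using (_on_)
open import Function.Bundles using (_⇔_; _↣_; Injection)
open import Induction.WellFounded using (WellFounded)
open import Level using (_⊔_; 0ℓ; Setω) renaming (suc to lsuc)
open import Relation.Binary.Core using (Rel)
open import Relation.Binary.PropositionalEquality.Core using (_≡_)
open import Relation.Binary.Structures using (IsTotalOrder; IsStrictTotalOrder)
import Relation.Binary.Construct.NonStrictToStrict as ToStrict
open import Relation.Nullary.Negation.Core using (¬_)
open import Relation.Unary using (Pred; _∈_)

-- The ambient theory is classical set theory with choice.  The library's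
-- ExcludedMiddle decides arbitrary types, not only propositions: from
-- ¬ ¬ A it returns an element of A.  Hence it also yields the axiom of
-- choice, which therefore needs no separate hypothesis.

record Classical : Setω where
  field
    excludedMiddle : ∀ {a} → ExcludedMiddle a

-- A cardinal is an initial ordinal: a well-order that does not inject
-- into any of its proper initial segments.  (The segment below α is not
-- formed as a type, since elements of a Σ-type would carry proofs of _<_.)

record Cardinal a : Set (lsuc a) where
  field
    Carrier            : Set a
    _<_                : Rel Carrier a
    isStrictTotalOrder : IsStrictTotalOrder _≡_ _<_
    wellFounded        : WellFounded _<_
    initial            : ∀ α → ¬ (Σ[ f ∈ Carrier ↣ Carrier ]
                                    (∀ ξ → Injection.to f ξ < α))

Infinite : ∀ {a} → Cardinal a → Set a
Infinite κ = ℕ ↣ Cardinal.Carrier κ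

record LinearOrderOn {a} (A : Set a) : Set (lsuc a) where
  field
    _≤_          : Rel A a
    isTotalOrder : IsTotalOrder _≡_ _≤_

  open ToStrict _≡_ _≤_ public using (_<_)

-- Nonemptiness is not a field here; it is part of membership in Lin below.

record LinearOrder a : Set (lsuc a) where
  constructor linearOrder
  field
    {Carrier} : Set a
    order     : LinearOrderOn Carrier

  open LinearOrderOn order public

ℚ-linearOrder : LinearOrder 0ℓ
ℚ-linearOrder = linearOrder (record { isTotalOrder = ≤ℚ-isTotalOrder })

-- Used both for linear orders and for quasi-orders.

IsEmbedding : ∀ {a b r s} {A : Set a} {B : Set b} →
              Rel A r → Rel B s → (A → B) → Set (a ⊔ r ⊔ s)
IsEmbedding R S f = ∀ x y → R x y ⇔ S (f x) (f y)

EmbedsInto : ∀ {a b r s} {A : Set a} {B : Set b} →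
             Rel A r → Rel B s → Set (a ⊔ b ⊔ r ⊔ s)
EmbedsInto R S = ∃[ f ] IsEmbedding R S f

infix 4 _≼_

_≼_ : ∀ {a b} → LinearOrder a → LinearOrder b → Set (a ⊔ b)
L ≼ L′ = EmbedsInto (LinearOrder._≤_ L) (LinearOrder._≤_ L′)

LO : ∀ {a} → Cardinal a → Set (lsuc a)
LO κ = LinearOrderOn (Cardinal.Carrier κ)

Lin : ∀ {a} → Cardinal a → Pred (LinearOrder a) a
Lin κ L = LinearOrder.Carrier L × (LinearOrder.Carrier L ↣ Cardinal.Carrier κ)

Scat : ∀ {a} → Cardinal a → Pred (LinearOrder a) a
Scat κ L = L ∈ Lin κ × ¬ (ℚ-linearOrder ≼ L)

-- Isomorphic orders embed into each other, so a downward closed class is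
-- automatically closed under isomorphism.

DownwardClosed : ∀ {a ℓ} → Cardinal a → Pred (LinearOrder a) ℓ → Set (lsuc a ⊔ ℓ)
DownwardClosed κ 𝓛 = ∀ {K L} → K ∈ Lin κ → K ≼ L → L ∈ 𝓛 → K ∈ 𝓛

IsConvex : ∀ {a p} (L : LinearOrder a) → Pred (LinearOrder.Carrier L) p → Set (a ⊔ p)
IsConvex L I = ∀ {x y z} → x ≤ y → y ≤ z → x ∈ I → z ∈ I → y ∈ I
  where open LinearOrder L

Image : ∀ {a b p} {A : Set a} {B : Set b} → (A → B) → Pred A p → Pred B (a ⊔ b ⊔ p)
Image f P y = ∃[ x ] x ∈ P × f x ≡ y

record ConvexPartition {a} (K L : LinearOrder a) : Set (lsuc a) where
  private
    module K = LinearOrder K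
    module L = LinearOrder L
  field
    part     : K.Carrier → Pred L.Carrier a
    nonempty : ∀ k → ∃[ x ] x ∈ part k
    covering : ∀ x → ∃[ k ] x ∈ part k
    disjoint : ∀ {k k′ x} → x ∈ part k → x ∈ part k′ → k ≡ k′
    ordered  : ∀ k k′ → (k K.< k′) ⇔
                        (∀ {x y} → x ∈ part k → y ∈ part k′ → x L.< y)

infix 4 _⊴[_]_

_⊴[_]_ : ∀ {a ℓ} → LinearOrder a → Pred (LinearOrder a) ℓ → LinearOrder a → Set (lsuc a ⊔ ℓ)
L ⊴[ 𝓛 ] L′ =
  Σ[ K ∈ LinearOrder _ ] K ∈ 𝓛 ×
  Σ[ P ∈ ConvexPartition K L ]
  Σ[ f ∈ (LinearOrder.Carrier L → LinearOrder.Carrier L′) ]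
    IsEmbedding (LinearOrder._≤_ L) (LinearOrder._≤_ L′) f ×
    (∀ k → IsConvex L′ (Image f (ConvexPartition.part P k)))

Restricted⊴ : ∀ {a ℓ} (κ : Cardinal a) → Pred (LinearOrder a) ℓ → Rel (LO κ) (lsuc a ⊔ ℓ)
Restricted⊴ κ 𝓛 L L′ = linearOrder L ⊴[ 𝓛 ] linearOrder L′

UpperCone : ∀ {a ℓ} (κ : Cardinal a) → Pred (LinearOrder a) ℓ → LO κ → Set (lsuc a ⊔ ℓ)
UpperCone κ 𝓛 L₀ = Σ[ L ∈ LO κ ] Restricted⊴ κ 𝓛 L₀ L

UpperCone⊴ : ∀ {a ℓ} (κ : Cardinal a) (𝓛 : Pred (LinearOrder a) ℓ) (L₀ : LO κ) →
             Rel (UpperCone κ 𝓛 L₀) (lsuc a ⊔ ℓ)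
UpperCone⊴ κ 𝓛 L₀ = Restricted⊴ κ 𝓛 on proj₁

{-# OPTIONS --safe #-}
module Submission where

-- Let M be the order ℚ × S + L₀ + ℚ, with lexicographic products, where S is
-- a well-order of size at most κ such that every element of S has an immediate
-- successor and S has no convex copy in L₀.  The embedding sends L to the
-- lexicographic product L × M, in which every point l of L is replaced by a
-- block β l + λ₀ l + ρ l isomorphic to M.
--
-- The order L₀ is isomorphic to the convex subset λ₀ l of L × M (L₀⊴inflate),
-- and a piecewise convex embedding f of L into L′ gives the piecewise convex
-- embedding f × id, over the same index order (inflate-mono).
--
-- The point is the converse (deflate).  Let f be an embedding of L × M into
-- L′ × M, convex on the parts of a K-convex partition with K scattered.
-- Since K is scattered, two points of β l in different copies of S lie in the
-- same part (scattered), and so does a whole copy of S between them.  The image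
-- of this copy is convex.  Immediate successors are preserved by f inside a
-- part; elements of β have them and elements of ρ do not.  So the image avoids
-- ρ and, since S has no convex copy in L₀, it meets some β l′ (hits-β).  Put
-- g l = l′, and put l in the part that contains the chosen copy of S.
-- The map g is strictly increasing: if l and m, with l below m, had the same
-- value, then the elements of ρ l would be sent into β l′, although two of
-- them lie in a common part (ρ↛β).  The images of the new parts are convex,
-- because the inverse of f on a block at y, which f covers, satisfies hits-β as
-- well, and the point of β l found in this way forces g l to be y
-- (same-block).
--
-- The order S exists because the sum over x of the well-ordered segments of L₀
-- starting at x has size at most κ × κ, and a well-order longer than this sum
-- has no convex copy in L₀ (S⋬L₀).  That L × M can be carried over to κ
-- follows from κ × κ having the size of κ (infinite-square), proved by
-- comparing κ with the Gödel well-order of its pairs, and from the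
-- Cantor-Bernstein theorem.

open import Defs
open import Relation.Binary.Definitions using (Transitive)
open import Relation.Unary using (Pred; _⊆_; Satisfiable)

open import Data.Bool.Properties using (T-irrelevant)
open import Data.Empty using (⊥-elim)
open import Data.Integer.Base using (ℤ; +_; -[1+_])
open import Data.Maybe.Base using (Maybe; just; nothing)
open import Data.Maybe.Properties using (just-injective)
open import Data.Nat.Base as ℕ using (ℕ; zero; suc; _+_; _*_)
import Data.Nat.Induction as ℕ
import Data.Nat.Properties as ℕ
open import Data.Product.Base using (Σ-syntax; ∃-syntax; _×_; _,_; proj₁; proj₂; uncurry)
open import Data.Product.Function.NonDependent.Propositional using (_×-↣_)
import Data.Product.Relation.Binary.Lex.NonStrict as Lex
open import Data.Product.Relation.Binary.Lex.Strict using (×-Lex; ×-compare; ×-wellFounded)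
open import Data.Product.Relation.Binary.Pointwise.NonDependent using (≡×≡⇒≡; ≡⇒≡×≡)
open import Data.Rational.Base as ℚ using (ℚ; mkℚ)
import Data.Rational.Properties as ℚ
open import Data.Sum.Base using (_⊎_; inj₁; inj₂)
open import Data.Sum.Function.Propositional using (_⊎-↣_)
open import Data.Sum.Relation.Binary.LeftOrder using (⊎-<-isTotalOrder; ₁∼₁; ₁∼₂; ₂∼₂)
open import Data.Sum.Relation.Binary.Pointwise using (Pointwise-≡⇒≡)
import Data.Unit.Polymorphic.Base as Unit
open import Function.Base using (_∘_; _on_; id)
open import Function.Bundles using (_↣_; Injection; mk↣; _↔_; Inverse; mk↔ₛ′; Equivalence; mk⇔)
open import Function.Construct.Composition using (_↣-∘_)
open import Function.Properties.Inverse using (↔⇒↣; ↔-sym; ↔-refl)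
open import Induction.WellFounded using (WellFounded; Acc; acc)
open import Level using (Level; _⊔_; 0ℓ) renaming (suc to lsuc)
open import Relation.Binary.Core using (Rel)
import Relation.Binary.Construct.On as On
import Relation.Binary.Construct.StrictToNonStrict as ToNonStrict
open import Relation.Binary.Definitions using (Trichotomous; Tri; tri<; tri≈; tri>)
open import Relation.Binary.PropositionalEquality
  using (_≡_; _≢_; refl; sym; trans; cong; cong₂; subst; subst₂; isEquivalence)
open import Relation.Binary.Structures using (IsStrictTotalOrder; IsTotalOrder)
open import Relation.Nullary.Decidable.Core
  using (Dec; yes; no; True; toWitness; fromWitness; decidable-stable)
open import Relation.Nullary.Negation.Core using (¬_)
open import Relation.Unary using (_∈_)

private
  variable
    a b c ℓ : Level
    A : Set a
    B : Set b

open Injection using (to; injective)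

------------------------------------------------------------------------
-- Countable sets

ℕ×ℕ↣ℕ : (ℕ × ℕ) ↣ ℕ
ℕ×ℕ↣ℕ = mk↣ {to = code} (λ {p} {q} → code-injective p q)
  where
  code : ℕ × ℕ → ℕ
  code (m , n) = (m + n) * (m + n) + m

  -- The sum of the entries is the integer square root of the code.
  code-mono : ∀ m n m′ n′ → m + n ℕ.< m′ + n′ → code (m , n) ℕ.< code (m′ , n′)
  code-mono m n m′ n′ s<s′ = begin-strict
    s * s + m           ≤⟨ ℕ.+-monoʳ-≤ (s * s) (ℕ.m≤m+n m n) ⟩
    s * s + s           ≡⟨ ℕ.+-comm (s * s) s ⟩
    suc s * s           <⟨ ℕ.*-monoʳ-< (suc s) (ℕ.n<1+n s) ⟩
    suc s * suc s       ≤⟨ ℕ.*-mono-≤ s<s′ s<s′ ⟩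
    s′ * s′             ≤⟨ ℕ.m≤m+n (s′ * s′) m′ ⟩
    s′ * s′ + m′        ∎
    where
    open ℕ.≤-Reasoning
    s  = m + n
    s′ = m′ + n′

  code-injective : ∀ p q → code p ≡ code q → p ≡ q
  code-injective (m , n) (m′ , n′) eq with ℕ.<-cmp (m + n) (m′ + n′)
  ... | tri< s<s′ _ _ = ⊥-elim (ℕ.<-irrefl eq (code-mono m n m′ n′ s<s′))
  ... | tri> _ _ s′<s = ⊥-elim (ℕ.<-irrefl (sym eq) (code-mono m′ n′ m n s′<s))
  ... | tri≈ _ s≡s′ _
    with refl ← ℕ.+-cancelˡ-≡ ((m + n) * (m + n)) m m′
                  (trans eq (cong (λ s → s * s + m′) (sym s≡s′)))
    with refl ← ℕ.+-cancelˡ-≡ m n n′ s≡s′ = refl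

ℤ↣ℕ : ℤ ↣ ℕ
ℤ↣ℕ = ℕ×ℕ↣ℕ ↣-∘ mk↣ {to = code} (λ {i} {j} → code-injective i j)
  where
  code : ℤ → ℕ × ℕ
  code (+ n)    = 0 , n
  code -[1+ n ] = 1 , n

  code-injective : ∀ i j → code i ≡ code j → i ≡ j
  code-injective (+ _)    (+ _)    refl = refl
  code-injective -[1+ _ ] -[1+ _ ] refl = refl

ℚ↣ℕ : ℚ ↣ ℕ
ℚ↣ℕ = ℕ×ℕ↣ℕ ↣-∘ (mk↣ (λ {p} {q} → code-injective p q))
  where
  code : ℚ → ℕ × ℕ
  code (mkℚ i d _) = to ℤ↣ℕ i , d

  code-injective : ∀ p q → code p ≡ code q → p ≡ q
  code-injective (mkℚ i d _) (mkℚ j e _) eq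
    with refl ← injective ℤ↣ℕ {i} {j} (cong proj₁ eq) | refl ← cong proj₂ eq = refl

Maybe↣ℕ : A ↣ ℕ → Maybe A ↣ ℕ
Maybe↣ℕ {A = A} f = mk↣ (λ {x} {y} → code-injective x y)
  where
  code : Maybe A → ℕ
  code nothing  = zero
  code (just x) = suc (to f x)

  code-injective : ∀ x y → code x ≡ code y → x ≡ y
  code-injective nothing  nothing  _  = refl
  code-injective (just x) (just y) eq = cong just (injective f (ℕ.suc-injective eq))

module _ {A : Set a} {x₀ x₁ : A} (x₀≢x₁ : x₀ ≢ x₁) where

  Maybe↣× : Maybe A ↣ (A × A)
  Maybe↣× = mk↣ (λ {x} {y} → code-injective x y)
    where
    code : Maybe A → A × A
    code nothing  = x₁ , x₁
    code (just x) = x₀ , x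

    code-injective : ∀ x y → code x ≡ code y → x ≡ y
    code-injective nothing  nothing  _  = refl
    code-injective nothing  (just _) eq = ⊥-elim (x₀≢x₁ (sym (cong proj₁ eq)))
    code-injective (just _) nothing  eq = ⊥-elim (x₀≢x₁ (cong proj₁ eq))
    code-injective (just _) (just _) eq = cong (just ∘ proj₂) eq

  ⊎↣× : (A ⊎ A) ↣ (A × A)
  ⊎↣× = mk↣ (λ {x} {y} → code-injective x y)
    where
    code : A ⊎ A → A × A
    code (inj₁ x) = x₀ , x
    code (inj₂ x) = x₁ , x

    code-injective : ∀ x y → code x ≡ code y → x ≡ y
    code-injective (inj₁ _) (inj₁ _) eq = cong (inj₁ ∘ proj₂) eq
    code-injective (inj₁ _) (inj₂ _) eq = ⊥-elim (x₀≢x₁ (cong proj₁ eq))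
    code-injective (inj₂ _) (inj₁ _) eq = ⊥-elim (x₀≢x₁ (sym (cong proj₁ eq)))
    code-injective (inj₂ _) (inj₂ _) eq = cong (inj₂ ∘ proj₂) eq

------------------------------------------------------------------------
-- Subsets

-- The elements satisfying P.  Membership is recorded as a Boolean, so that
-- elements with the same first component are equal.
Subset : {A : Set a} {P : A → Set ℓ} → (∀ x → Dec (P x)) → Set a
Subset {A = A} P? = Σ[ x ∈ A ] True (P? x)

module _ {A : Set a} {P : A → Set ℓ} (P? : ∀ x → Dec (P x)) where

  subset : ∀ x → P x → Subset P?
  subset x px = x , fromWitness {a? = P? x} px

  member : (u : Subset P?) → P (proj₁ u)
  member (x , t) = toWitness {a? = P? x} t

  proj₁-injective : {u v : Subset P?} → proj₁ u ≡ proj₁ v → u ≡ v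
  proj₁-injective {x , s} {_ , t} refl = cong (x ,_) (T-irrelevant s t)

  Subset↣ : Subset P? ↣ A
  Subset↣ = mk↣ proj₁-injective

------------------------------------------------------------------------
-- Well-orders

-- The relation is strict; its trichotomy is relative to propositional
-- equality.
record WellOrder a ℓ : Set (lsuc (a ⊔ ℓ)) where
  field
    Carrier     : Set a
    _<_         : Rel Carrier ℓ
    compare     : Trichotomous _≡_ _<_
    <-trans     : Transitive _<_
    wellFounded : WellFounded _<_

  _<?_ : ∀ x y → Dec (x < y)
  x <? y with compare x y
  ... | tri< x<y _ _ = yes x<y
  ... | tri≈ x≮y _ _ = no x≮y
  ... | tri> x≮y _ _ = no x≮y

  irrefl : ∀ {x} → ¬ (x < x)
  irrefl {x} x<x with compare x x
  ... | tri< _ x≢x _ = x≢x refl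
  ... | tri≈ x≮x _ _ = x≮x x<x
  ... | tri> _ x≢x _ = x≢x refl

-- The order pulled back along an injection.
restrict : (W : WellOrder b ℓ) (f : A → WellOrder.Carrier W) →
           (∀ {x y} → f x ≡ f y → x ≡ y) → WellOrder _ ℓ
restrict {A = A} W f f-inj = record
  { Carrier     = A
  ; _<_         = _<_ on f
  ; compare     = compare′
  ; <-trans     = <-trans
  ; wellFounded = On.wellFounded f wellFounded
  }
  where
  open WellOrder W
  compare′ : Trichotomous _≡_ (_<_ on f)
  compare′ x y with compare (f x) (f y)
  ... | tri< lt ne gt = tri< lt (ne ∘ cong f) gt
  ... | tri≈ lt eq gt = tri≈ lt (f-inj eq) gt
  ... | tri> lt ne gt = tri> lt (ne ∘ cong f) gt

lexWellOrder : ∀ {a b r s} → WellOrder a r → WellOrder b s → WellOrder (a ⊔ b) (a ⊔ r ⊔ s)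
lexWellOrder V V′ = record
  { Carrier = V.Carrier × V′.Carrier
  ; _<_     = ×-Lex _≡_ V._<_ V′._<_
  ; compare = compare′
  ; <-trans = λ
      { (inj₁ p)          (inj₁ q)          → inj₁ (V.<-trans p q)
      ; (inj₁ p)          (inj₂ (refl , _)) → inj₁ p
      ; (inj₂ (refl , _)) (inj₁ q)          → inj₁ q
      ; (inj₂ (refl , p)) (inj₂ (refl , q)) → inj₂ (refl , V′.<-trans p q)
      }
  ; wellFounded = ×-wellFounded V.wellFounded V′.wellFounded
  }
  where
  module V = WellOrder V
  module V′ = WellOrder V′
  compare′ : Trichotomous _≡_ (×-Lex _≡_ V._<_ V′._<_)
  compare′ p q with ×-compare {_<₁_ = V._<_} {_<₂_ = V′._<_} sym V.compare V′.compare p q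
  ... | tri< lt ne gt = tri< lt (ne ∘ ≡⇒≡×≡) gt
  ... | tri≈ lt eq gt = tri≈ lt (≡×≡⇒≡ eq) gt
  ... | tri> lt ne gt = tri> lt (ne ∘ ≡⇒≡×≡) gt

-- The proper initial segment of the elements below x.
below : (W : WellOrder a ℓ) → WellOrder.Carrier W → WellOrder a ℓ
below W x = restrict W proj₁ (proj₁-injective (λ y → y <? x))
  where open WellOrder W

Below : (W : WellOrder a ℓ) → WellOrder.Carrier W → Set a
Below W x = WellOrder.Carrier (below W x)

module ClassicalSets (classical : Classical) where
  open Classical classical renaming (excludedMiddle to em)

  ¬¬-elim : {P : Set ℓ} → ¬ ¬ P → P
  ¬¬-elim = decidable-stable em

  minimal : {_<_ : Rel A b} → WellFounded _<_ → (P : A → Set ℓ) →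
            ∀ {x} → P x → ∃[ y ] P y × (∀ {z} → z < y → ¬ P z)
  minimal {A = A} {_<_ = _<_} wf P {x} = go (wf x)
    where
    go : ∀ {x} → Acc _<_ x → P x → ∃[ y ] P y × (∀ {z} → z < y → ¬ P z)
    go {x} (acc rs) px with em {P = ∃[ z ] z < x × P z}
    ... | yes (z , z<x , pz) = go (rs z<x) pz
    ... | no  none           = x , px , λ z<x pz → none (_ , z<x , pz)

  -- Of two well-orders, the first injects into the second or the second
  -- injects into a proper initial segment of the first.
  module Comparability (V : WellOrder a ℓ) (W : WellOrder b c) where
    private
      module V = WellOrder V
      module W = WellOrder W

    -- The segments below v and below w are isomorphic: this relation itself
    -- restricts to an isomorphism between them.
    data Match (v : V.Carrier) (w : W.Carrier) : Set (a ⊔ b ⊔ ℓ ⊔ c) where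
      match : (∀ {v′} → v′ V.< v → ∃[ w′ ] w′ W.< w × Match v′ w′) →
              (∀ {w′} → w′ W.< w → ∃[ v′ ] v′ V.< v × Match v′ w′) →
              Match v w

    match-functional : ∀ {v w w′} → Match v w → Match v w′ → w ≡ w′
    match-functional {v} = go (V.wellFounded v)
      where
      go : ∀ {v w w′} → Acc V._<_ v → Match v w → Match v w′ → w ≡ w′
      go {w = w} {w′} (acc rs) (match f g) (match f′ g′) with W.compare w w′
      ... | tri≈ _ w≡w′ _ = w≡w′
      ... | tri< w<w′ _ _ =
        let v′ , v′<v , m = g′ w<w′ ; w″ , w″<w , m″ = f v′<v in
        ⊥-elim (W.irrefl (subst (W._< w) (go (rs v′<v) m″ m) w″<w))
      ... | tri> _ _ w′<w =
        let v′ , v′<v , m = g w′<w ; w″ , w″<w′ , m″ = f′ v′<v in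
        ⊥-elim (W.irrefl (subst (W._< w′) (go (rs v′<v) m″ m) w″<w′))

    match-injective : ∀ {v v′ w} → Match v w → Match v′ w → v ≡ v′
    match-injective {v} {v′} {w} m@(match f _) m′@(match f′ _) with V.compare v v′
    ... | tri≈ _ v≡v′ _ = v≡v′
    ... | tri< v<v′ _ _ =
      let w′ , w′<w , m″ = f′ v<v′ in
      ⊥-elim (W.irrefl (subst (W._< w) (match-functional m″ m) w′<w))
    ... | tri> _ _ v′<v =
      let w′ , w′<w , m″ = f v′<v in
      ⊥-elim (W.irrefl (subst (W._< w) (match-functional m″ m′) w′<w))

    comparable : (V.Carrier ↣ W.Carrier) ⊎ (∃[ v ] W.Carrier ↣ Below V v)
    comparable with em {P = ∃[ v ] ¬ (∃[ w ] Match v w)}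
    ... | no none = inj₁ (mk↣ {to = λ v → proj₁ (partner v)} λ {v} {v′} eq →
                      match-injective (proj₂ (partner v))
                        (subst (Match v′) (sym eq) (proj₂ (partner v′))))
      where
      partner : ∀ v → ∃[ w ] Match v w
      partner v = ¬¬-elim λ unmatched → none (v , unmatched)
    ... | yes (v₀ , unmatched₀) = inj₂ (v , mk↣ {to = into} into-injective)
      where
      least = minimal V.wellFounded (λ v → ¬ (∃[ w ] Match v w)) unmatched₀
      v     = proj₁ least

      partner : ∀ {v′} → v′ V.< v → ∃[ w ] Match v′ w
      partner v′<v = ¬¬-elim (proj₂ (proj₂ least) v′<v)

      Hit : W.Carrier → Set _
      Hit w = ∃[ v′ ] v′ V.< v × Match v′ w

      partners-below : ∀ {w v′ w′} → ¬ Hit w → v′ V.< v → Match v′ w′ → w′ W.< w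
      partners-below {w} {v′} {w′} missed v′<v m@(match _ g) with W.compare w′ w
      ... | tri< w′<w _ _ = w′<w
      ... | tri≈ _ refl _ = ⊥-elim (missed (v′ , v′<v , m))
      ... | tri> _ _ w<w′ =
        let v″ , v″<v′ , m″ = g w<w′ in
        ⊥-elim (missed (v″ , V.<-trans v″<v′ v′<v , m″))

      -- A least w missed by the elements below v would match v.
      hit : ∀ w → Hit w
      hit w₀ = ¬¬-elim λ missed₀ →
        let w , missed , hits = minimal W.wellFounded (λ w → ¬ Hit w) missed₀ in
        proj₁ (proj₂ least)
          (w , match (λ v′<v → let w′ , m = partner v′<v in
                               w′ , partners-below missed v′<v m , m)
                     (λ w′<w → ¬¬-elim (hits w′<w)))

      into : W.Carrier → Below V v
      into w = subset (V._<? v) (proj₁ (hit w)) (proj₁ (proj₂ (hit w)))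

      into-injective : ∀ {w w′} → into w ≡ into w′ → w ≡ w′
      into-injective {w} {w′} eq =
        match-functional (proj₂ (proj₂ (hit w)))
          (subst (λ v′ → Match v′ w′) (sym (cong proj₁ eq)) (proj₂ (proj₂ (hit w′))))

  -- The Gödel order: pairs are compared by their maximum, then
  -- lexicographically.
  module Gödel (W : WellOrder a ℓ) where
    open WellOrder W

    max : Carrier → Carrier → Carrier
    max x y with x <? y
    ... | yes _ = y
    ... | no  _ = x

    max-boundˡ : ∀ x y → ¬ (max x y < x)
    max-boundˡ x y lt with x <? y
    ... | yes x<y = irrefl (<-trans lt x<y)
    ... | no  _   = irrefl lt

    max-boundʳ : ∀ x y → ¬ (max x y < y)
    max-boundʳ x y lt with x <? y
    ... | yes _   = irrefl lt
    ... | no  x≮y = x≮y lt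

    key : Carrier × Carrier → (Carrier × Carrier) × Carrier
    key (x , y) = (max x y , x) , y

    gödel : WellOrder a (a ⊔ ℓ)
    gödel = restrict (lexWellOrder (lexWellOrder W W) W) key
      λ eq → cong₂ _,_ (cong (proj₂ ∘ proj₁) eq) (cong proj₂ eq)

    -- A pair below p has both entries at most m, the maximum of p; the value
    -- nothing stands for m itself.
    Below-gödel↣ : ∀ p → let m = uncurry max p in
                   Below gödel p ↣ (Maybe (Below W m) × Maybe (Below W m))
    Below-gödel↣ p = mk↣ {to = code} code-injective
      where
      m = uncurry max p
      open WellOrder gödel using () renaming (_<_ to _≺_; _<?_ to _≺?_)

      cut : ∀ x → Tri (x < m) (x ≡ m) (m < x) → Maybe (Below W m)
      cut x (tri< x<m _ _) = just (subset (_<? m) x x<m)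
      cut x (tri≈ _ _ _)   = nothing
      cut x (tri> _ _ _)   = nothing

      cut-injective : ∀ {x y} → ¬ (m < x) → ¬ (m < y) → ∀ s t → cut x s ≡ cut y t → x ≡ y
      cut-injective m≮x m≮y (tri< _ _ _)   (tri< _ _ _)   eq   = cong proj₁ (just-injective eq)
      cut-injective m≮x m≮y (tri≈ _ p _)   (tri≈ _ q _)   _    = trans p (sym q)
      cut-injective m≮x m≮y (tri> _ _ m<x) _              _    = ⊥-elim (m≮x m<x)
      cut-injective m≮x m≮y _              (tri> _ _ m<y) _    = ⊥-elim (m≮y m<y)

      code : Below gödel p → Maybe (Below W m) × Maybe (Below W m)
      code ((x , y) , _) = cut x (compare x m) , cut y (compare y m)

      max≤ : ∀ {q} → q ≺ p → ¬ (m < uncurry max q)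
      max≤     (inj₁ (inj₁ lt))       gt = irrefl (<-trans lt gt)
      max≤ {q} (inj₁ (inj₂ (eq , _))) gt = irrefl (subst (_< uncurry max q) (sym eq) gt)
      max≤ {q} (inj₂ (eq , _))        gt = irrefl (subst (_< uncurry max q) (sym (cong proj₁ eq)) gt)

      ≮-trans : ∀ {x y} → ¬ (m < x) → ¬ (x < y) → ¬ (m < y)
      ≮-trans {x} {y} m≮x x≮y m<y with compare x y
      ... | tri< x<y _ _  = x≮y x<y
      ... | tri≈ _ refl _ = m≮x m<y
      ... | tri> _ _ y<x  = m≮x (<-trans m<y y<x)

      code-injective : ∀ {q r} → code q ≡ code r → q ≡ r
      code-injective {q@((x , y) , _)} {r@((x′ , y′) , _)} eq = proj₁-injective (_≺? p)
        (cong₂ _,_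
          (cut-injective (≮-trans q≤ (max-boundˡ x y)) (≮-trans r≤ (max-boundˡ x′ y′))
            _ _ (cong proj₁ eq))
          (cut-injective (≮-trans q≤ (max-boundʳ x y)) (≮-trans r≤ (max-boundʳ x′ y′))
            _ _ (cong proj₂ eq)))
        where
        q≤ = max≤ (member (_≺? p) q)
        r≤ = max≤ (member (_≺? p) r)

  -- A is countable or absorbs its square.  Finite sets need the first case.
  CountableOrSquare : Set a → Set a
  CountableOrSquare A = (A ↣ ℕ) ⊎ ((A × A) ↣ A)

  CountableOrSquare-resp : A ↣ B → B ↣ A → CountableOrSquare A → CountableOrSquare B
  CountableOrSquare-resp f g (inj₁ h) = inj₁ (h ↣-∘ g)
  CountableOrSquare-resp f g (inj₂ h) = inj₂ (f ↣-∘ (h ↣-∘ (g ×-↣ g)))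

  -- If the pairs of elements of W do not inject into W, then W injects into
  -- a proper segment of the Gödel order, hence into the square of a segment
  -- S of W with one element added.  By hypothesis S is countable or absorbs
  -- its square, and then also the added element, unless it is trivial.
  square-step : (W : WellOrder a ℓ) → (∀ x → CountableOrSquare (Below W x)) →
                CountableOrSquare (WellOrder.Carrier W)
  square-step W IH with Comparability.comparable (Gödel.gödel W) W
  ... | inj₁ f = inj₂ f
  ... | inj₂ (p , f) = from-IH (IH m)
    where
    open WellOrder W
    open Gödel W
    m = uncurry max p
    S = Below W m

    W↣ : Carrier ↣ (Maybe S × Maybe S)
    W↣ = Below-gödel↣ p ↣-∘ f

    countable : S ↣ ℕ → Carrier ↣ ℕ
    countable g = ℕ×ℕ↣ℕ ↣-∘ ((Maybe↣ℕ g ×-↣ Maybe↣ℕ g) ↣-∘ W↣)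

    from-IH : CountableOrSquare S → CountableOrSquare Carrier
    from-IH (inj₁ g) = inj₁ (countable g)
    from-IH (inj₂ g) with em {P = Σ[ s ∈ S ] Σ[ t ∈ S ] s ≢ t}
    ... | no trivial = inj₁ (countable (mk↣ {to = λ _ → 0} λ {s} {t} _ →
                         ¬¬-elim λ s≢t → trivial (s , t , s≢t)))
    ... | yes (_ , _ , s≢t) = inj₂ (Subset↣ (_<? m) ↣-∘ (g ↣-∘ (W↣S ×-↣ W↣S)))
      where
      Maybe↣S : Maybe S ↣ S
      Maybe↣S = g ↣-∘ Maybe↣× s≢t

      W↣S : Carrier ↣ S
      W↣S = g ↣-∘ ((Maybe↣S ×-↣ Maybe↣S) ↣-∘ W↣)

  square : (W : WellOrder a ℓ) → CountableOrSquare (WellOrder.Carrier W)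
  square W = square-step W λ x → go (wellFounded x)
    where
    open WellOrder W

    go : ∀ {x} → Acc _<_ x → CountableOrSquare (Below W x)
    go {x} (acc rs) = square-step (below W x) λ u@(y , _) →
      let y<x  = member (_<? x) u
          _<ᵤ? = λ z → WellOrder._<?_ (below W x) z u
      in
      -- The segment of y in the segment of x is the segment of y in W.
      CountableOrSquare-resp
        (mk↣ {to = λ v → subset _<ᵤ?
                     (subset (_<? x) (proj₁ v) (<-trans (member (_<? y) v) y<x))
                     (member (_<? y) v)}
             (λ eq → proj₁-injective (_<? y) (cong (proj₁ ∘ proj₁) eq)))
        (mk↣ {to = λ v → subset (_<? y) (proj₁ (proj₁ v)) (member _<ᵤ? v)}
             (λ eq → proj₁-injective _<ᵤ? (proj₁-injective (_<? x) (cong proj₁ eq))))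
        (go (rs y<x))

  -- Hessenberg's theorem.
  infinite-square : (W : WellOrder a ℓ) → ℕ ↣ WellOrder.Carrier W →
                    (WellOrder.Carrier W × WellOrder.Carrier W) ↣ WellOrder.Carrier W
  infinite-square W e with square W
  ... | inj₁ f = e ↣-∘ (ℕ×ℕ↣ℕ ↣-∘ (f ×-↣ f))
  ... | inj₂ f = f

  -- The elements of A whose chain of alternating preimages under g and f
  -- ends in A.
  data Stops {A : Set a} {B : Set b} (f : A ↣ B) (g : B ↣ A) : A → Set (a ⊔ b) where
    start : ∀ {x} → ¬ (∃[ y ] to g y ≡ x) → Stops f g x
    step  : ∀ {x} → Stops f g x → Stops f g (to g (to f x))

  cantor-bernstein : {A : Set a} {B : Set b} → A ↣ B → B ↣ A → A ↔ B
  cantor-bernstein {A = A} {B = B} f g = mk↔ₛ′ forth back forth-back back-forth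
    where
    stops? : ∀ x → Dec (Stops f g x)
    stops? _ = em

    back-exists : ∀ {x} → ¬ Stops f g x → ∃[ y ] to g y ≡ x
    back-exists ¬s = ¬¬-elim (¬s ∘ start)

    forth′ : ∀ {x} → Dec (Stops f g x) → B
    forth′ {x} (yes _) = to f x
    forth′     (no ¬s) = proj₁ (back-exists ¬s)

    previous : ∀ {y} → Stops f g (to g y) → ∃[ x ] Stops f g x × to f x ≡ y
    previous s = go s refl
      where
      go : ∀ {x y} → Stops f g x → x ≡ to g y → ∃[ x′ ] Stops f g x′ × to f x′ ≡ y
      go (start none) eq = ⊥-elim (none (_ , sym eq))
      go (step s)     eq = _ , s , injective g eq

    back′ : ∀ {y} → Dec (Stops f g (to g y)) → A
    back′     (yes s) = proj₁ (previous s)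
    back′ {y} (no _)  = to g y

    forth : A → B
    forth x = forth′ (stops? x)

    back : B → A
    back y = back′ (stops? (to g y))

    forth-back′ : ∀ {y} (d : Dec (Stops f g (to g y))) (d′ : Dec (Stops f g (back′ d))) →
                  forth′ d′ ≡ y
    forth-back′ (yes s) (yes _) = proj₂ (proj₂ (previous s))
    forth-back′ (yes s) (no ¬s) = ⊥-elim (¬s (proj₁ (proj₂ (previous s))))
    forth-back′ (no ¬s) (yes s) = ⊥-elim (¬s s)
    forth-back′ (no _)  (no ¬s) = injective g (proj₂ (back-exists ¬s))

    forth-back : ∀ y → forth (back y) ≡ y
    forth-back y = forth-back′ (stops? (to g y)) (stops? (back y))

    back-forth′ : ∀ {x} (d : Dec (Stops f g x)) (d′ : Dec (Stops f g (to g (forth′ d)))) →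
                  back′ d′ ≡ x
    back-forth′ (yes _) (yes s) = injective f (proj₂ (proj₂ (previous s)))
    back-forth′ (yes s) (no ¬s) = ⊥-elim (¬s (step s))
    back-forth′ (no ¬s) (yes s) = ⊥-elim (¬s (subst (Stops f g) (proj₂ (back-exists ¬s)) s))
    back-forth′ (no ¬s) (no _)  = proj₂ (back-exists ¬s)

    back-forth : ∀ x → back (forth x) ≡ x
    back-forth x = back-forth′ (stops? x) (stops? (to g (forth x)))

------------------------------------------------------------------------
-- Linear orders

module Order (L : LinearOrder a) where
  open LinearOrder L public
  open IsTotalOrder isTotalOrder public
    using (antisym; total) renaming (refl to ≤-refl; trans to ≤-trans)

  <-irrefl : ∀ {x} → ¬ (x < x)
  <-irrefl (_ , x≢x) = x≢x refl

  <⇒≱ : ∀ {x y} → x < y → ¬ (y ≤ x)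
  <⇒≱ (x≤y , x≢y) y≤x = x≢y (antisym x≤y y≤x)

  ≰⇒> : ∀ {x y} → ¬ (x ≤ y) → y < x
  ≰⇒> {x} {y} x≰y with total x y
  ... | inj₁ x≤y = ⊥-elim (x≰y x≤y)
  ... | inj₂ y≤x = y≤x , λ { refl → x≰y y≤x }

  infix 4 _⋖_

  -- y is the immediate successor of x.
  _⋖_ : Rel Carrier a
  x ⋖ y = x < y × (∀ {z} → x < z → ¬ (z < y))

-- Strict monotonicity.
Monotone : (L : LinearOrder a) (L′ : LinearOrder b) →
           (LinearOrder.Carrier L → LinearOrder.Carrier L′) → Set (a ⊔ b)
Monotone L L′ f = ∀ {x y} → x L.< y → f x L′.< f y
  where
  module L = LinearOrder L
  module L′ = LinearOrder L′

module Embedding (L : LinearOrder a) (L′ : LinearOrder b)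
                 {f : LinearOrder.Carrier L → LinearOrder.Carrier L′}
                 (f-emb : IsEmbedding (LinearOrder._≤_ L) (LinearOrder._≤_ L′) f) where
  private
    module L = Order L
    module L′ = Order L′

  mono : ∀ {x y} → x L.≤ y → f x L′.≤ f y
  mono = Equivalence.to (f-emb _ _)

  reflect : ∀ {x y} → f x L′.≤ f y → x L.≤ y
  reflect = Equivalence.from (f-emb _ _)

  inj : ∀ {x y} → f x ≡ f y → x ≡ y
  inj eq = L.antisym (reflect (subst (f _ L′.≤_) eq L′.≤-refl))
                     (reflect (subst (L′._≤ f _) eq L′.≤-refl))

  <-mono : Monotone L L′ f
  <-mono (x≤y , x≢y) = mono x≤y , x≢y ∘ inj

  <-reflect : ∀ {x y} → f x L′.< f y → x L.< y
  <-reflect (le , ne) = reflect le , ne ∘ cong f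

  -- f maps the interval from x to z onto the interval from f x to f z.
  OntoInterval : L.Carrier → L.Carrier → Set (a ⊔ b)
  OntoInterval x z = ∀ {y} → f x L′.≤ y → y L′.≤ f z → ∃[ w ] x L.≤ w × w L.≤ z × f w ≡ y

  subinterval : ∀ {x x′ z z′} → x L.≤ x′ → z′ L.≤ z → OntoInterval x z → OntoInterval x′ z′
  subinterval x≤x′ z′≤z onto p q
    with onto (L′.≤-trans (mono x≤x′) p) (L′.≤-trans q (mono z′≤z))
  ... | w , _ , _ , refl = w , reflect p , reflect q , refl

  ⋖-image : ∀ {x w z} → OntoInterval x z → x L.⋖ w → w L.≤ z → f x L′.⋖ f w
  ⋖-image {x} {w} onto (x<w , gap) w≤z = <-mono x<w , λ {y} fx<y y<fw →
    let u , _ , _ , fu≡y = onto (proj₁ fx<y) (L′.≤-trans (proj₁ y<fw) (mono w≤z)) in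
    gap (<-reflect (subst (f x L′.<_) (sym fu≡y) fx<y))
        (<-reflect (subst (L′._< f w) (sym fu≡y) y<fw))

  ⋖-preimage : ∀ {x y z} → OntoInterval x z → f x L′.⋖ y → y L′.≤ f z → ∃[ w ] x L.⋖ w
  ⋖-preimage onto (fx<y , gap) y≤fz with onto (proj₁ fx<y) y≤fz
  ... | w , _ , _ , refl = w , <-reflect fx<y , λ x<u u<w → gap (<-mono x<u) (<-mono u<w)

≡-isTotalOrder : ∀ {r s} {_≈_ : Rel A r} {_≤_ : Rel A s} → (∀ {x y} → x ≈ y → x ≡ y) →
                 IsTotalOrder _≈_ _≤_ → IsTotalOrder _≡_ _≤_
≡-isTotalOrder ≈⇒≡ to = record
  { isPartialOrder = record
    { isPreorder = record
      { isEquivalence = isEquivalence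
      ; reflexive     = λ { refl → TO.refl }
      ; trans         = TO.trans
      }
    ; antisym = λ x≤y y≤x → ≈⇒≡ (TO.antisym x≤y y≤x)
    }
  ; total = TO.total
  }
  where module TO = IsTotalOrder to

pullback : (L : LinearOrder b) (f : A → LinearOrder.Carrier L) →
           (∀ {x y} → f x ≡ f y → x ≡ y) → IsTotalOrder _≡_ (LinearOrder._≤_ L on f)
pullback L f f-inj = ≡-isTotalOrder f-inj (On.isTotalOrder f (LinearOrder.isTotalOrder L))

-- The order is opaque so that the endpoints of an inequality can be
-- inferred from its type; the same holds for the lexicographic product.
opaque
  sumOn : {A : Set a} {B : Set b} → LinearOrderOn A → LinearOrderOn B → LinearOrderOn (A ⊎ B)
  sumOn L L′ = record
    { isTotalOrder = ≡-isTotalOrder Pointwise-≡⇒≡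
        (⊎-<-isTotalOrder (LinearOrderOn.isTotalOrder L) (LinearOrderOn.isTotalOrder L′)) }

-- All elements of the first order precede those of the second.
sumOrder : LinearOrder a → LinearOrder b → LinearOrder (a ⊔ b)
sumOrder L L′ = linearOrder (sumOn (LinearOrder.order L) (LinearOrder.order L′))

module SumOrder (L : LinearOrder a) (L′ : LinearOrder b) where
  private
    module L = Order L
    module L′ = Order L′
  open Order (sumOrder L L′)

  opaque
    unfolding sumOn

    inj₁-≤ : ∀ {x y} → x L.≤ y → inj₁ x ≤ inj₁ y
    inj₁-≤ = ₁∼₁

    inj₂-≤ : ∀ {x y} → x L′.≤ y → inj₂ x ≤ inj₂ y
    inj₂-≤ = ₂∼₂

    inj₁-≤⁻ : ∀ {x y} → inj₁ x ≤ inj₁ y → x L.≤ y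
    inj₁-≤⁻ (₁∼₁ x≤y) = x≤y

    inj₂-≤⁻ : ∀ {x y} → inj₂ x ≤ inj₂ y → x L′.≤ y
    inj₂-≤⁻ (₂∼₂ x≤y) = x≤y

    inj₁<inj₂ : ∀ {x y} → inj₁ x < inj₂ y
    inj₁<inj₂ = ₁∼₂ , λ ()

    inj₂≰inj₁ : ∀ {x y} → ¬ (inj₂ x ≤ inj₁ y)
    inj₂≰inj₁ ()

  inj₁-< : ∀ {x y} → x L.< y → inj₁ x < inj₁ y
  inj₁-< (x≤y , x≢y) = inj₁-≤ x≤y , λ { refl → x≢y refl }

  inj₂-< : ∀ {x y} → x L′.< y → inj₂ x < inj₂ y
  inj₂-< (x≤y , x≢y) = inj₂-≤ x≤y , λ { refl → x≢y refl }

  inj₁-<⁻ : ∀ {x y} → inj₁ x < inj₁ y → x L.< y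
  inj₁-<⁻ (x≤y , x≢y) = inj₁-≤⁻ x≤y , x≢y ∘ cong inj₁

  inj₂-<⁻ : ∀ {x y} → inj₂ x < inj₂ y → x L′.< y
  inj₂-<⁻ (x≤y , x≢y) = inj₂-≤⁻ x≤y , x≢y ∘ cong inj₂

  inj₁-⋖ : ∀ {x y} → x L.⋖ y → inj₁ x ⋖ inj₁ y
  inj₁-⋖ {x} {y} (x<y , gap) = inj₁-< x<y , no-between
    where
    no-between : ∀ {z} → inj₁ x < z → ¬ (z < inj₁ y)
    no-between {inj₁ z} x<z z<y = gap (inj₁-<⁻ x<z) (inj₁-<⁻ z<y)
    no-between {inj₂ z} _ z<y = inj₂≰inj₁ (proj₁ z<y)

-- The suborder of the elements satisfying P.
subOrder : (L : LinearOrder a) {P : LinearOrder.Carrier L → Set ℓ} → (∀ x → Dec (P x)) →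
           LinearOrder a
subOrder L P? = linearOrder {Carrier = Subset P?} record
  { isTotalOrder = pullback L proj₁ (proj₁-injective P?) }

subOrder-< : (L : LinearOrder a) {P : LinearOrder.Carrier L → Set ℓ} (P? : ∀ x → Dec (P x)) →
             Monotone (subOrder L P?) L proj₁
subOrder-< L P? (u≤v , u≢v) = u≤v , u≢v ∘ proj₁-injective P?

module ClassicalOrders (classical : Classical) where
  open Classical classical renaming (excludedMiddle to em)
  open ClassicalSets classical

  opaque
    lexOn : {A : Set a} {B : Set b} → LinearOrderOn A → LinearOrderOn B → LinearOrderOn (A × B)
    lexOn L L′ = record
      { isTotalOrder = ≡-isTotalOrder ≡×≡⇒≡
          (Lex.×-isTotalOrder (λ _ _ → em)
            (LinearOrderOn.isTotalOrder L) (LinearOrderOn.isTotalOrder L′)) }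

  -- The product L × L′ ordered by the first entry, then by the second: the
  -- sum over L of copies of L′.
  lexOrder : LinearOrder a → LinearOrder b → LinearOrder (a ⊔ b)
  lexOrder L L′ = linearOrder (lexOn (LinearOrder.order L) (LinearOrder.order L′))

  module LexOrder (L : LinearOrder a) (L′ : LinearOrder b) where
    private
      module L = Order L
      module L′ = Order L′
    open Order (lexOrder L L′)

    opaque
      unfolding lexOn

      lex-<₁ : ∀ {x y m n} → x L.< y → (x , m) < (y , n)
      lex-<₁ x<y = inj₁ x<y , λ { refl → L.<-irrefl x<y }

      lex-≤₂ : ∀ {x m n} → m L′.≤ n → (x , m) ≤ (x , n)
      lex-≤₂ m≤n = inj₂ (refl , m≤n)

      lex-≤₁⁻ : ∀ {x y m n} → (x , m) ≤ (y , n) → x L.≤ y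
      lex-≤₁⁻ (inj₁ (x≤y , _))  = x≤y
      lex-≤₁⁻ (inj₂ (refl , _)) = L.≤-refl

      lex-≤₂⁻ : ∀ {x m n} → (x , m) ≤ (x , n) → m L′.≤ n
      lex-≤₂⁻ (inj₁ (_ , x≢x)) = ⊥-elim (x≢x refl)
      lex-≤₂⁻ (inj₂ (_ , m≤n)) = m≤n

      lex-<⁻ : ∀ {x y m n} → (x , m) < (y , n) → x L.< y ⊎ (x ≡ y × m L′.< n)
      lex-<⁻ (inj₁ x<y , _)           = inj₁ x<y
      lex-<⁻ (inj₂ (refl , m≤n) , ne) = inj₂ (refl , m≤n , ne ∘ cong (_ ,_))

    lex-<₂ : ∀ {x m n} → m L′.< n → (x , m) < (x , n)
    lex-<₂ (m≤n , m≢n) = lex-≤₂ m≤n , λ { refl → m≢n refl }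

    lex-<₂⁻ : ∀ {x m n} → (x , m) < (x , n) → m L′.< n
    lex-<₂⁻ (le , ne) = lex-≤₂⁻ le , ne ∘ cong (_ ,_)

    between : ∀ {x m n w} → (x , m) ≤ w → w ≤ (x , n) →
              ∃[ k ] w ≡ (x , k) × m L′.≤ k × k L′.≤ n
    between {w = y , k} p q with refl ← L.antisym (lex-≤₁⁻ p) (lex-≤₁⁻ q) =
      k , refl , lex-≤₂⁻ p , lex-≤₂⁻ q

    lex-⋖ : ∀ {x m n} → m L′.⋖ n → (x , m) ⋖ (x , n)
    lex-⋖ {x} {m} {n} (m<n , gap) = lex-<₂ m<n , no-between
      where
      no-between : ∀ {w} → (x , m) < w → ¬ (w < (x , n))
      no-between x<w w<y with between (proj₁ x<w) (proj₁ w<y)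
      ... | k , refl , _ = gap (lex-<₂⁻ x<w) (lex-<₂⁻ w<y)

  module _ (L : LinearOrder a) where
    open Order L

    ≤⇒<⊎≡ : ∀ {x y} → x ≤ y → x < y ⊎ x ≡ y
    ≤⇒<⊎≡ {x} {y} x≤y with em {P = x ≡ y}
    ... | yes x≡y = inj₂ x≡y
    ... | no  x≢y = inj₁ (x≤y , x≢y)

  Monotone⇒IsEmbedding : (L : LinearOrder a) (L′ : LinearOrder b) → ∀ {f} → Monotone L L′ f →
                         IsEmbedding (LinearOrder._≤_ L) (LinearOrder._≤_ L′) f
  Monotone⇒IsEmbedding L L′ {f} f-mono x y = mk⇔ mono reflect
    where
    module L = Order L
    module L′ = Order L′
    mono : x L.≤ y → f x L′.≤ f y
    mono x≤y with ≤⇒<⊎≡ L x≤y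
    ... | inj₁ x<y  = proj₁ (f-mono x<y)
    ... | inj₂ refl = L′.≤-refl
    reflect : f x L′.≤ f y → x L.≤ y
    reflect fx≤fy = ¬¬-elim λ x≰y → L′.<⇒≱ (f-mono (L.≰⇒> x≰y)) fx≤fy

  ----------------------------------------------------------------------
  -- Convex partitions

  module Partition {K L : LinearOrder a} (P : ConvexPartition K L) where
    open ConvexPartition P
    private
      module K = Order K
      module L = Order L

    part-≤ : ∀ {x y k k′} → x ∈ part k → y ∈ part k′ → x L.≤ y → k K.≤ k′
    part-≤ x∈k y∈k′ x≤y = ¬¬-elim λ k≰k′ →
      L.<⇒≱ (Equivalence.to (ordered _ _) (K.≰⇒> k≰k′) y∈k′ x∈k) x≤y

    part-convex : ∀ k → IsConvex L (part k)
    part-convex k {y = y} x≤y y≤z x∈k z∈k =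
      let k′ , y∈k′ = covering y in
      subst (λ k → y ∈ part k) (K.antisym (part-≤ y∈k′ z∈k y≤z) (part-≤ x∈k y∈k′ x≤y)) y∈k′

    -- Otherwise choosing the part of each point of the copy of the rationals
    -- would embed the rationals into K.
    abstract
      scattered : ¬ (ℚ-linearOrder ≼ K) → ∀ {e} → Monotone ℚ-linearOrder L e →
                  ∃[ q ] ∃[ q′ ] ∃[ k ]
                    LinearOrder._<_ ℚ-linearOrder q q′ × e q ∈ part k × e q′ ∈ part k
      scattered ℚ⋠K {e} e-mono = ¬¬-elim λ none →
        ℚ⋠K (h , Monotone⇒IsEmbedding ℚ-linearOrder K λ {q} {q′} q<q′ →
          part-≤ (h∈ q) (h∈ q′) (proj₁ (e-mono q<q′)) ,
          λ hq≡hq′ → none (q , q′ , h q , q<q′ , h∈ q ,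
                           subst (λ k → e q′ ∈ part k) (sym hq≡hq′) (h∈ q′)))
        where
        h : ℚ → K.Carrier
        h q = proj₁ (covering (e q))
        h∈ : ∀ q → e q ∈ part (h q)
        h∈ q = proj₂ (covering (e q))

  ----------------------------------------------------------------------
  -- The rationals

  module Q = Order ℚ-linearOrder

  ℚ-< : ∀ {q r} → q ℚ.< r → q Q.< r
  ℚ-< q<r = ℚ.<⇒≤ q<r , ℚ.<⇒≢ q<r

  abstract
    ℚ-dense : ∀ {q r} → q Q.< r → ∃[ p ] q Q.< p × p Q.< r
    ℚ-dense q<r = let p , q<p , p<r = ℚ.<-dense (ℚ.≰⇒> (Q.<⇒≱ q<r)) in p , ℚ-< q<p , ℚ-< p<r

  ℚ-unbounded : ∀ q → q Q.< q ℚ.+ ℚ.1ℚ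
  ℚ-unbounded q = ℚ-< (subst (ℚ._< q ℚ.+ ℚ.1ℚ) (ℚ.+-identityʳ q)
                        (ℚ.+-monoʳ-< q (ℚ.positive⁻¹ ℚ.1ℚ)))

  ----------------------------------------------------------------------
  -- Replacing each point of an order by a block

  -- A strictly monotone map with convex image.
  record ConvexMap (L : LinearOrder a) (L′ : LinearOrder b) : Set (a ⊔ b) where
    private
      module L = LinearOrder L
      module L′ = LinearOrder L′
    field
      map    : L.Carrier → L′.Carrier
      mono   : Monotone L L′ map
      convex : ∀ {s t y} → map s L′.≤ y → y L′.≤ map t → ∃[ u ] map u ≡ y

  -- S is any nonempty order in which every element has an immediate successor
  -- and which has no convex copy in L₀.
  module Blocks (L₀ S : LinearOrder a) (s₀ : LinearOrder.Carrier S)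
                (next : ∀ s → ∃[ t ] Order._⋖_ S s t)
                (S⋬L₀ : ¬ ConvexMap S L₀) where

    private
      module L₀ = Order L₀
      module S = Order S

    ℚS : LinearOrder a
    ℚS = lexOrder ℚ-linearOrder S

    -- The block ℚ × S + L₀ + ℚ.
    M : LinearOrder a
    M = sumOrder ℚS (sumOrder L₀ ℚ-linearOrder)

    private
      module M = Order M
      module ℚS = LexOrder ℚ-linearOrder S
      module MS = SumOrder ℚS (sumOrder L₀ ℚ-linearOrder)
      module MR = SumOrder L₀ ℚ-linearOrder

    -- Every point of L is replaced by a copy of M.
    inflate : LinearOrder a → LinearOrder a
    inflate L = lexOrder L M

    module Inflate (L : LinearOrder a) where
      private module L = Order L
      open Order (inflate L) public
      open LexOrder L M public

      -- The three parts of the block at l: β is ℚ × S, λ₀ is L₀ and ρ is the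
      -- final ℚ.
      β : L.Carrier → ℚ → S.Carrier → Carrier
      β l q s = l , inj₁ (q , s)

      λ₀ : L.Carrier → L₀.Carrier → Carrier
      λ₀ l x = l , inj₂ (inj₁ x)

      ρ : L.Carrier → ℚ → Carrier
      ρ l q = l , inj₂ (inj₂ q)

      β-⋖ : ∀ l q {s t} → s S.⋖ t → β l q s ⋖ β l q t
      β-⋖ l q s⋖t = lex-⋖ (MS.inj₁-⋖ (ℚS.lex-⋖ s⋖t))

      β-mono : ∀ l s → Monotone ℚ-linearOrder (inflate L) (λ q → β l q s)
      β-mono l s q<r = lex-<₂ (MS.inj₁-< (ℚS.lex-<₁ q<r))

      β-monoₛ : ∀ l q → Monotone S (inflate L) (β l q)
      β-monoₛ l q s<t = lex-<₂ (MS.inj₁-< (ℚS.lex-<₂ s<t))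

      ρ-mono : ∀ l → Monotone ℚ-linearOrder (inflate L) (ρ l)
      ρ-mono l q<r = lex-<₂ (MS.inj₂-< (MR.inj₂-< q<r))

      β-between : ∀ {l q s q′ s′ w} → β l q s ≤ w → w ≤ β l q′ s′ → ∃[ r ] ∃[ t ] w ≡ β l r t
      β-between p p′ with between p p′
      ... | inj₁ (r , t) , refl , _ = r , t , refl
      ... | inj₂ _ , refl , _ , m≤ = ⊥-elim (MS.inj₂≰inj₁ m≤)

      β-betweenₛ : ∀ {l q s s′ w} → β l q s ≤ w → w ≤ β l q s′ → ∃[ t ] w ≡ β l q t
      β-betweenₛ p p′ with between p p′
      ... | inj₂ _ , refl , _ , m≤ = ⊥-elim (MS.inj₂≰inj₁ m≤)
      ... | inj₁ u , refl , r , r′ with ℚS.between (MS.inj₁-≤⁻ r) (MS.inj₁-≤⁻ r′)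
      ...   | t , refl , _ = t , refl

      -- No element of ρ has an immediate successor: ρ l is dense, without a
      -- greatest element, and ends its block.
      ρ-dense : ∀ {l q y} → ¬ (ρ l q ⋖ y)
      ρ-dense {l} {q} {y , m} (lt , gap) with lex-<⁻ lt
      ... | inj₁ l<y = gap (ρ-mono l (ℚ-unbounded q)) (lex-<₁ l<y)
      ρ-dense {l} {q} {_ , inj₁ _} (lt , gap) | inj₂ (refl , m<m′) = MS.inj₂≰inj₁ (proj₁ m<m′)
      ρ-dense {l} {q} {_ , inj₂ (inj₁ _)} (lt , gap) | inj₂ (refl , m<m′) =
        MR.inj₂≰inj₁ (MS.inj₂-≤⁻ (proj₁ m<m′))
      ρ-dense {l} {q} {_ , inj₂ (inj₂ r)} (lt , gap) | inj₂ (refl , m<m′) =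
        let p , q<p , p<r = ℚ-dense (MR.inj₂-<⁻ (MS.inj₂-<⁻ m<m′)) in
        gap (ρ-mono l q<p) (ρ-mono l p<r)

      λ₀-<₂⁻ : ∀ {l x y} → λ₀ l x < λ₀ l y → x L₀.< y
      λ₀-<₂⁻ lt = MR.inj₁-<⁻ (MS.inj₂-<⁻ (lex-<₂⁻ lt))

      λ₀<ρ : ∀ {l x q} → λ₀ l x < ρ l q
      λ₀<ρ = lex-<₂ (MS.inj₂-< MR.inj₁<inj₂)

      β<ρ : ∀ {l q s r} → β l q s < ρ l r
      β<ρ = lex-<₂ MS.inj₁<inj₂

      λ₀-between : ∀ {l x y w} → λ₀ l x ≤ w → w ≤ λ₀ l y → ∃[ z ] w ≡ λ₀ l z
      λ₀-between p p′ with between p p′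
      ... | inj₁ _ , refl , m≤ , _ = ⊥-elim (MS.inj₂≰inj₁ m≤)
      ... | inj₂ (inj₂ _) , refl , _ , m≤ = ⊥-elim (MR.inj₂≰inj₁ (MS.inj₂-≤⁻ m≤))
      ... | inj₂ (inj₁ z) , refl , _ = z , refl

    -- The image avoids ρ, as S has successors and ρ has none.  If it avoided β
    -- too, it would lie in the λ₀ part of a single block, because different
    -- blocks are separated by ρ, and S would have a convex copy in L₀.
    abstract
      hits-β : (L : LinearOrder a) (h : ConvexMap S (inflate L)) →
               ∃[ s ] ∃[ l ] ∃[ q ] ∃[ t ] ConvexMap.map h s ≡ Inflate.β L l q t
      hits-β L h = ¬¬-elim λ none → S⋬L₀ (copy-in-L₀ none)
        where
        open ConvexMap h
        open Inflate L
        module L = Order L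

        not-ρ : ∀ {s l q} → ¬ (map s ≡ ρ l q)
        not-ρ {s} eq with next s
        ... | t , s<t , gap =
          ρ-dense (subst (_⋖ map t) eq (mono s<t , λ {z} ms<z z<mt → no-between ms<z z<mt))
          where
          no-between : ∀ {z} → map s < z → ¬ (z < map t)
          no-between ms<z z<mt with convex (proj₁ ms<z) (proj₁ z<mt)
          ... | u , refl = gap (reflect ms<z) (reflect z<mt)
            where
            reflect : ∀ {s t} → map s < map t → s S.< t
            reflect (le , ne) =
              Equivalence.from (Monotone⇒IsEmbedding S (inflate L) mono _ _) le , ne ∘ cong map

        module _ (none : ¬ (∃[ s ] ∃[ l ] ∃[ q ] ∃[ t ] map s ≡ β l q t)) where

          in-λ₀ : ∀ s → ∃[ l ] ∃[ x ] map s ≡ λ₀ l x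
          in-λ₀ s = go (map s) refl
            where
            go : ∀ y → map s ≡ y → ∃[ l ] ∃[ x ] map s ≡ λ₀ l x
            go (l , inj₁ (q , t))  eq = ⊥-elim (none (s , l , q , t , eq))
            go (l , inj₂ (inj₁ x)) eq = l , x , eq
            go (l , inj₂ (inj₂ q)) eq = ⊥-elim (not-ρ eq)

          block : S.Carrier → L.Carrier
          block s = proj₁ (in-λ₀ s)

          pos : S.Carrier → L₀.Carrier
          pos s = proj₁ (proj₂ (in-λ₀ s))

          map≡ : ∀ s → map s ≡ λ₀ (block s) (pos s)
          map≡ s = proj₂ (proj₂ (in-λ₀ s))

          block-≮ : ∀ s t → ¬ (block s L.< block t)
          block-≮ s t lt with convex {s} {t} {ρ (block s) ℚ.0ℚ}
            (subst (_≤ ρ (block s) ℚ.0ℚ) (sym (map≡ s)) (proj₁ λ₀<ρ))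
            (subst (ρ (block s) ℚ.0ℚ ≤_) (sym (map≡ t)) (proj₁ (lex-<₁ lt)))
          ... | u , eq = not-ρ eq

          block-const : ∀ s t → block s ≡ block t
          block-const s t = L.antisym (¬¬-elim λ s≰t → block-≮ t s (L.≰⇒> s≰t))
                                      (¬¬-elim λ t≰s → block-≮ s t (L.≰⇒> t≰s))

          l₀ = block s₀

          map≡′ : ∀ s → map s ≡ λ₀ l₀ (pos s)
          map≡′ s = trans (map≡ s) (cong (λ l → λ₀ l (pos s)) (block-const s s₀))

          copy-in-L₀ : ConvexMap S L₀
          copy-in-L₀ = record
            { map    = pos
            ; mono   = λ {s} {t} s<t → λ₀-<₂⁻ (subst₂ _<_ (map≡′ s) (map≡′ t) (mono s<t))
            ; convex = λ {s} {t} {y} p p′ →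
                let u , eq = convex {s} {t} {λ₀ l₀ y}
                      (subst (_≤ λ₀ l₀ y) (sym (map≡′ s)) (lex-≤₂ (MS.inj₂-≤ (MR.inj₁-≤ p))))
                      (subst (λ₀ l₀ y ≤_) (sym (map≡′ t)) (lex-≤₂ (MS.inj₂-≤ (MR.inj₁-≤ p′))))
                in u , λ₀-injective (trans (sym (map≡′ u)) eq)
            }
            where
            λ₀-injective : ∀ {l l′ x y} → λ₀ l x ≡ λ₀ l′ y → x ≡ y
            λ₀-injective refl = refl

    -- From an embedding f of inflate L into inflate L′ that is convex on the
    -- parts of a partition over a scattered K, an embedding g of L into L′ that
    -- is convex on the parts of a partition over a suborder of K.
    module Deflate {K : LinearOrder a} (ℚ⋠K : ¬ (ℚ-linearOrder ≼ K)) (L L′ : LinearOrder a)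
                   (P : ConvexPartition K (inflate L))
                   (f : LinearOrder.Carrier (inflate L) → LinearOrder.Carrier (inflate L′))
                   (f-emb : IsEmbedding (LinearOrder._≤_ (inflate L)) (LinearOrder._≤_ (inflate L′)) f)
                   (f-convex : ∀ k → IsConvex (inflate L′) (Image f (ConvexPartition.part P k)))
                   where
      open ConvexPartition P
      open Partition P
      open Embedding (inflate L) (inflate L′) f-emb
      private
        module K = Order K
        module L = Order L
        module L′ = Order L′
        module X = Inflate L
        module X′ = Inflate L′

      onto : ∀ {x z k} → x ∈ part k → z ∈ part k → OntoInterval x z
      onto {k = k} x∈k z∈k p q with f-convex k p q (_ , x∈k , refl) (_ , z∈k , refl)
      ... | w , w∈k , refl = w , reflect p , reflect q , refl

      -- A point of β l that f sends to β target, and the index of its part.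
      record Sample (l : L.Carrier) : Set a where
        field
          {q}       : ℚ
          {s}       : S.Carrier
          index     : K.Carrier
          sampled   : X.β l q s ∈ part index
          target    : L′.Carrier
          {q′}      : ℚ
          {s′}      : S.Carrier
          image     : f (X.β l q s) ≡ X′.β target q′ s′

        point : X.Carrier
        point = X.β l q s

      -- Between q and q″ a whole copy of S lies in the part k; its image, being
      -- convex, meets some β.
      sample-in : ∀ {l q q″ k} → q Q.< q″ → X.β l q s₀ ∈ part k → X.β l q″ s₀ ∈ part k → Sample l
      sample-in {l} {q} {q″} {k} q<q″ q∈k q″∈k =
        let r , q<r , r<q″ = ℚ-dense q<q″ in sample-at r q<r r<q″
        where
        module _ (r : ℚ) (q<r : q Q.< r) (r<q″ : r Q.< q″) where
          in-part : ∀ s → X.β l r s ∈ part k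
          in-part s = part-convex k
            (proj₁ (X.lex-<₂ (MS.inj₁-< (ℚS.lex-<₁ q<r))))
            (proj₁ (X.lex-<₂ (MS.inj₁-< (ℚS.lex-<₁ r<q″))))
            q∈k q″∈k

          copy : ConvexMap S (inflate L′)
          copy = record
            { map    = λ s → f (X.β l r s)
            ; mono   = λ s<t → <-mono (X.β-monoₛ l r s<t)
            ; convex = λ {s} {t} p p′ →
                let w , s≤w , w≤t , fw≡y = onto (in-part s) (in-part t) p p′
                    u , w≡β = X.β-betweenₛ s≤w w≤t
                in u , trans (cong f (sym w≡β)) fw≡y
            }

          sample-at : Sample l
          sample-at =
            let s , _ , _ , _ , fs≡β = hits-β L′ copy in
            record { sampled = in-part s ; image = fs≡β }

      abstract
        sample : ∀ l → Sample l
        sample l = let _ , _ , _ , q<q″ , q∈k , q″∈k = scattered ℚ⋠K (X.β-mono l s₀) in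
                   sample-in q<q″ q∈k q″∈k

      -- The new embedding g, and the index ι of the part given to l.
      module _ (l : L.Carrier) where
        open Sample (sample l) public using () renaming (index to ι; target to g; point to pt)

      pt∈ : ∀ l → pt l ∈ part (ι l)
      pt∈ l = Sample.sampled (sample l)

      f-pt : ∀ l → f (pt l) ≡ X′.β (g l) (Sample.q′ (sample l)) (Sample.s′ (sample l))
      f-pt l = Sample.image (sample l)

      pt-< : ∀ {l m} → l L.< m → pt l X.< pt m
      pt-< = X.lex-<₁

      g-≤ : ∀ {l m} → l L.< m → g l L′.≤ g m
      g-≤ {l} {m} l<m = X′.lex-≤₁⁻ (subst₂ X′._≤_ (f-pt l) (f-pt m) (proj₁ (<-mono (pt-< l<m))))

      -- An element of β has an immediate successor, which would pull back to an
      -- immediate successor in ρ.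
      ρ↛β : ∀ {l r r′ m q t} → r Q.< r′ → OntoInterval (X.ρ l r) (X.ρ l r′) →
            ¬ (f (X.ρ l r) ≡ X′.β m q t)
      ρ↛β {l} {r} {r′} {m} {q} {t} r<r′ onto′ eq = X.ρ-dense (proj₂ (⋖-preimage onto′ cover next≤))
        where
        cover : f (X.ρ l r) X′.⋖ X′.β m q (proj₁ (next t))
        cover = subst (X′._⋖ X′.β m q (proj₁ (next t))) (sym eq) (X′.β-⋖ m q (proj₂ (next t)))

        next≤ : X′.β m q (proj₁ (next t)) X′.≤ f (X.ρ l r′)
        next≤ = ¬¬-elim λ t⁺≰ → proj₂ cover (<-mono (X.ρ-mono l r<r′)) (X′.≰⇒> t⁺≰)

      -- If g l and g m were equal, ρ l, lying between the sample points of l and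
      -- of m, would be sent into β.
      abstract
        g-≢ : ∀ {l m} → l L.< m → ¬ (g l ≡ g m)
        g-≢ {l} {m} l<m gl≡gm =
          let r , r′ , _ , r<r′ , r∈k , r′∈k = scattered ℚ⋠K (X.ρ-mono l)
              _ , _ , eq = X′.β-between
                (subst (X′._≤ f (X.ρ l r)) (f-pt l) (mono (proj₁ X.β<ρ)))
                (subst (f (X.ρ l r) X′.≤_) (f-pt-m gl≡gm) (mono (proj₁ (X.lex-<₁ l<m))))
          in ρ↛β r<r′ (onto r∈k r′∈k) eq
          where
          f-pt-m : g l ≡ g m → f (pt m) ≡ X′.β (g l) (Sample.q′ (sample m)) (Sample.s′ (sample m))
          f-pt-m gl≡gm = trans (f-pt m)
            (cong (λ l′ → X′.β l′ (Sample.q′ (sample m)) (Sample.s′ (sample m))) (sym gl≡gm))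

      g-mono : Monotone L L′ g
      g-mono l<m = g-≤ l<m , g-≢ l<m

      -- A convex image of an interval of β l has its endpoints in one block,
      -- if they lie in β: otherwise it contains an element of ρ, but every
      -- element of β l has an immediate successor.
      abstract
        same-block : ∀ {l q s r t m n q′ s′ r′ t′} → OntoInterval (X.β l q s) (X.β l r t) →
                     X.β l q s X.≤ X.β l r t →
                     f (X.β l q s) ≡ X′.β m q′ s′ → f (X.β l r t) ≡ X′.β n r′ t′ → m ≡ n
        same-block {l} {q} {s} {r} {t} {m} {n} onto′ c≤e fc fe
          with ≤⇒<⊎≡ L′ (X′.lex-≤₁⁻ (subst₂ X′._≤_ fc fe (mono c≤e)))
        ... | inj₂ m≡n = m≡n
        ... | inj₁ m<n with onto′ (subst (X′._≤ X′.ρ m ℚ.0ℚ) (sym fc) (proj₁ X′.β<ρ))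
                                  (subst (X′.ρ m ℚ.0ℚ X′.≤_) (sym fe) (proj₁ (X′.lex-<₁ m<n)))
        ...   | w , c≤w , w≤e , fw with X.β-between c≤w w≤e
        ...     | p , u , refl = ⊥-elim (X′.ρ-dense (subst (X′._⋖ f (X.β l p (proj₁ (next u)))) fw
                  (⋖-image (subinterval c≤w X.≤-refl onto′) (X.β-⋖ l p (proj₂ (next u))) u⁺≤e)))
          where
          ρ≢β : ∀ {l l′ q r s} → ¬ (X′.ρ l q ≡ X′.β l′ r s)
          ρ≢β ()

          w<e : X.β l p u X.< X.β l r t
          w<e = w≤e , λ w≡e → ρ≢β (trans (sym fw) (trans (cong f w≡e) fe))

          u⁺≤e : X.β l p (proj₁ (next u)) X.≤ X.β l r t
          u⁺≤e = ¬¬-elim λ u⁺≰e → proj₂ (X.β-⋖ l p (proj₂ (next u))) w<e (X.≰⇒> u⁺≰e)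

      ι-convex : ∀ {k} → IsConvex L (λ l → ι l ≡ k)
      ι-convex {k} {x} {y} {z} x≤y y≤z ιx ιz with ≤⇒<⊎≡ L x≤y | ≤⇒<⊎≡ L y≤z
      ... | inj₂ refl | _         = ιx
      ... | inj₁ _    | inj₂ refl = ιz
      ... | inj₁ x<y  | inj₁ y<z  = disjoint (pt∈ y)
        (part-convex k (proj₁ (pt-< x<y)) (proj₁ (pt-< y<z))
          (subst (λ k → pt x ∈ part k) ιx (pt∈ x)) (subst (λ k → pt z ∈ part k) ιz (pt∈ z)))

      -- For y strictly between g x and g z, the block at y lies in the image of
      -- the part k.  Pulling back a copy of S in it gives a point e of some β l
      -- with f e in β y, and same-block shows that g l is y.
      g-convex : ∀ k → IsConvex L′ (Image g (λ l → ι l ≡ k))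
      g-convex k {y = y} p p′ (x , ιx , refl) (z , ιz , refl)
        with ≤⇒<⊎≡ L′ p | ≤⇒<⊎≡ L′ p′
      ... | inj₂ refl | _         = x , ιx , refl
      ... | inj₁ _    | inj₂ refl = z , ιz , refl
      ... | inj₁ gx<y | inj₁ y<gz = l , ιl , gl≡y
        where
        x∈k : pt x ∈ part k
        x∈k = subst (λ k → pt x ∈ part k) ιx (pt∈ x)

        z∈k : pt z ∈ part k
        z∈k = subst (λ k → pt z ∈ part k) ιz (pt∈ z)

        preimage : ∀ m → ∃[ w ] pt x X.≤ w × w X.≤ pt z × f w ≡ (y , m)
        preimage m = onto x∈k z∈k
          (subst (X′._≤ (y , m)) (sym (f-pt x)) (proj₁ (X′.lex-<₁ gx<y)))
          (subst ((y , m) X′.≤_) (sym (f-pt z)) (proj₁ (X′.lex-<₁ y<gz)))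

        h : S.Carrier → X.Carrier
        h s = proj₁ (preimage (inj₁ (ℚ.0ℚ , s)))

        fh : ∀ s → f (h s) ≡ X′.β y ℚ.0ℚ s
        fh s = proj₂ (proj₂ (proj₂ (preimage (inj₁ (ℚ.0ℚ , s)))))

        copy : ConvexMap S (inflate L)
        copy = record
          { map    = h
          ; mono   = λ {s} {t} s<t →
              <-reflect (subst₂ X′._<_ (sym (fh s)) (sym (fh t)) (X′.β-monoₛ y ℚ.0ℚ s<t))
          ; convex = λ {s} {t} {v} hs≤v v≤ht →
              let u , fv = X′.β-betweenₛ (subst (X′._≤ f v) (fh s) (mono hs≤v))
                                         (subst (f v X′.≤_) (fh t) (mono v≤ht))
              in u , inj (trans (fh u) (sym fv))
          }

        hit = hits-β L copy
        s = proj₁ hit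
        l = proj₁ (proj₂ hit)
        q = proj₁ (proj₂ (proj₂ hit))
        t = proj₁ (proj₂ (proj₂ (proj₂ hit)))
        e = X.β l q t
        hs≡e : h s ≡ e
        hs≡e = proj₂ (proj₂ (proj₂ (proj₂ hit)))

        fe : f e ≡ X′.β y ℚ.0ℚ s
        fe = trans (cong f (sym hs≡e)) (fh s)

        x≤e : pt x X.≤ e
        x≤e = subst (pt x X.≤_) hs≡e (proj₁ (proj₂ (preimage (inj₁ (ℚ.0ℚ , s)))))

        e≤z : e X.≤ pt z
        e≤z = subst (X._≤ pt z) hs≡e (proj₁ (proj₂ (proj₂ (preimage (inj₁ (ℚ.0ℚ , s))))))

        e∈k : e ∈ part k
        e∈k = part-convex k x≤e e≤z x∈k z∈k

        ιl : ι l ≡ k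
        ιl = ι-convex (X.lex-≤₁⁻ x≤e) (X.lex-≤₁⁻ e≤z) ιx ιz

        l∈k : pt l ∈ part k
        l∈k = subst (λ k → pt l ∈ part k) ιl (pt∈ l)

        gl≡y : g l ≡ y
        gl≡y with X.total (pt l) e
        ... | inj₁ pt≤e = same-block (onto l∈k e∈k) pt≤e (f-pt l) fe
        ... | inj₂ e≤pt = sym (same-block (onto e∈k l∈k) e≤pt fe (f-pt l))

      Used : K.Carrier → Set a
      Used k = ∃[ l ] ι l ≡ k

      used? : ∀ k → Dec (Used k)
      used? _ = em

      -- Indices in K whose part receives no point of L are discarded.
      K₀ : LinearOrder a
      K₀ = subOrder K used?

      K₀≼K : K₀ ≼ K
      K₀≼K = proj₁ , λ _ _ → mk⇔ id id

      P₀ : ConvexPartition K₀ L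
      P₀ = record
        { part     = λ k l → ι l ≡ proj₁ k
        ; nonempty = λ k → member used? k
        ; covering = λ l → subset used? (ι l) (l , refl) , refl
        ; disjoint = λ p p′ → proj₁-injective used? (trans (sym p) p′)
        ; ordered  = λ k k′ → mk⇔
            (λ k<k′ → λ {x} {y} → forwards (subOrder-< K used? {k} {k′} k<k′) {x} {y})
            (λ less → backwards k k′ λ {x} {y} → less {x} {y})
        }
        where
        forwards : ∀ {k k′} → k K.< k′ → ∀ {x y} → ι x ≡ k → ι y ≡ k′ → x L.< y
        forwards k<k′ {x} {y} refl refl = L.≰⇒> λ y≤x →
          K.<⇒≱ k<k′ (part-≤ (pt∈ y) (pt∈ x) (pt-≤ y≤x))
          where
          pt-≤ : ∀ {l m} → l L.≤ m → pt l X.≤ pt m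
          pt-≤ l≤m with ≤⇒<⊎≡ L l≤m
          ... | inj₁ l<m  = proj₁ (pt-< l<m)
          ... | inj₂ refl = X.≤-refl

        backwards : ∀ k k′ → (∀ {x y} → ι x ≡ proj₁ k → ι y ≡ proj₁ k′ → x L.< y) →
                    LinearOrder._<_ K₀ k k′
        backwards k k′ less with member used? k | member used? k′
        ... | x , ιx | y , ιy = Order.≰⇒> K₀ λ k′≤k → excluded (≤⇒<⊎≡ K k′≤k)
          where
          excluded : ¬ (proj₁ k′ K.< proj₁ k ⊎ proj₁ k′ ≡ proj₁ k)
          excluded (inj₁ k′<k) = L.<⇒≱ (forwards k′<k ιy ιx) (proj₁ (less ιx ιy))
          excluded (inj₂ k′≡k) = L.<-irrefl (less ιx (trans ιx (sym k′≡k)))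

    deflate : ∀ {ℓ} (𝓛 : Pred (LinearOrder a) ℓ) →
              (∀ {K} → K ∈ 𝓛 → ¬ (ℚ-linearOrder ≼ K)) →
              (∀ {K₀ K} → LinearOrder.Carrier K₀ → K₀ ≼ K → K ∈ 𝓛 → K₀ ∈ 𝓛) →
              ∀ {L L′} → LinearOrder.Carrier L → inflate L ⊴[ 𝓛 ] inflate L′ → L ⊴[ 𝓛 ] L′
    deflate 𝓛 scat down {L} {L′} l₀ (K , K∈𝓛 , P , f , f-emb , f-convex) =
      K₀ , down (proj₁ (ConvexPartition.covering P₀ l₀)) K₀≼K K∈𝓛 ,
      P₀ , g , Monotone⇒IsEmbedding L L′ g-mono , λ k → g-convex (proj₁ k)
      where open Deflate (scat K∈𝓛) L L′ P f f-emb f-convex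

    inflate-mono : ∀ {ℓ} (𝓛 : Pred (LinearOrder a) ℓ) → ∀ {L L′} →
                   L ⊴[ 𝓛 ] L′ → inflate L ⊴[ 𝓛 ] inflate L′
    inflate-mono 𝓛 {L} {L′} (K , K∈𝓛 , P , f , f-emb , f-convex) =
      K , K∈𝓛 , P′ , f′ , Monotone⇒IsEmbedding (inflate L) (inflate L′) f′-mono , f′-convex
      where
      open ConvexPartition P
      open Embedding L L′ f-emb
      module X = Inflate L
      module X′ = Inflate L′
      module L = Order L
      m₀ : M.Carrier
      m₀ = inj₂ (inj₂ ℚ.0ℚ)

      P′ : ConvexPartition K (inflate L)
      P′ = record
        { part     = λ k x → proj₁ x ∈ part k
        ; nonempty = λ k → let x , x∈k = nonempty k in (x , m₀) , x∈k
        ; covering = λ x → covering (proj₁ x)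
        ; disjoint = disjoint
        ; ordered  = λ k k′ → mk⇔
            (λ k<k′ {x} {y} x∈k y∈k′ →
              X.lex-<₁ (Equivalence.to (ordered k k′) k<k′ {proj₁ x} {proj₁ y} x∈k y∈k′))
            (λ less → Equivalence.from (ordered k k′) λ {x} {y} x∈k y∈k′ →
              first-< (less {x , m₀} {y , m₀} x∈k y∈k′))
        }
        where
        first-< : ∀ {x y} → (x , m₀) X.< (y , m₀) → x L.< y
        first-< lt with X.lex-<⁻ lt
        ... | inj₁ x<y         = x<y
        ... | inj₂ (_ , m₀<m₀) = ⊥-elim (M.<-irrefl m₀<m₀)

      f′ : X.Carrier → X′.Carrier
      f′ (x , m) = f x , m

      f′-mono : Monotone (inflate L) (inflate L′) f′
      f′-mono {_ , _} {_ , _} lt with X.lex-<⁻ lt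
      ... | inj₁ x<y          = X′.lex-<₁ (<-mono x<y)
      ... | inj₂ (refl , m<n) = X′.lex-<₂ m<n

      f′-convex : ∀ k → IsConvex (inflate L′) (Image f′ (λ x → proj₁ x ∈ part k))
      f′-convex k {y = y , m} p q ((x , _) , x∈k , refl) ((z , _) , z∈k , refl)
        with f-convex k (X′.lex-≤₁⁻ p) (X′.lex-≤₁⁻ q) (x , x∈k , refl) (z , z∈k , refl)
      ... | w , w∈k , refl = (w , m) , w∈k , refl

    -- The map λ₀ l is convex on all of L₀, so a one-point K suffices.
    L₀⊴inflate : ∀ {ℓ} {𝓛 : Pred (LinearOrder a) ℓ} {K} → K ∈ 𝓛 → (k : LinearOrder.Carrier K) →
                 (∀ x → x ≡ k) → ∀ {L} → LinearOrder.Carrier L → L₀.Carrier →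
                 L₀ ⊴[ 𝓛 ] inflate L
    L₀⊴inflate {K = K} K∈𝓛 k k-unique {L} l x₀ =
      K , K∈𝓛 , P , λ₀ l ,
      Monotone⇒IsEmbedding L₀ (inflate L) (λ x<y → lex-<₂ (MS.inj₂-< (MR.inj₁-< x<y))) ,
      λ _ → convex
      where
      open Inflate L
      P : ConvexPartition K L₀
      P = record
        { part     = λ _ _ → Unit.⊤
        ; nonempty = λ _ → x₀ , Unit.tt
        ; covering = λ _ → k , Unit.tt
        ; disjoint = λ _ _ → trans (k-unique _) (sym (k-unique _))
        ; ordered  = λ k k′ → mk⇔
            (λ (_ , k≢k′) → ⊥-elim (k≢k′ (trans (k-unique k) (sym (k-unique k′)))))
            (λ less → ⊥-elim (L₀.<-irrefl (less {x₀} {x₀} Unit.tt Unit.tt)))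
        }

      convex : IsConvex (inflate L) (Image (λ₀ l) (λ _ → Unit.⊤))
      convex p q (x , _ , refl) (y , _ , refl) =
        let z , w≡λ₀ = λ₀-between p q in z , Unit.tt , sym w≡λ₀

  ----------------------------------------------------------------------
  -- Isomorphic orders

  infix 4 _≅_

  _≅_ : LinearOrder a → LinearOrder b → Set (a ⊔ b)
  L ≅ L′ = Σ[ i ∈ LinearOrder.Carrier L ↔ LinearOrder.Carrier L′ ]
             IsEmbedding (LinearOrder._≤_ L) (LinearOrder._≤_ L′) (Inverse.to i)

  module _ (L L′ : LinearOrder a) where
    private module L′ = LinearOrder L′

    ≅-sym : L ≅ L′ → L′ ≅ L
    ≅-sym (i , emb) = ↔-sym i , λ x y → mk⇔
      (λ x≤y → Equivalence.from (emb _ _) (subst₂ L′._≤_ (sym (to-from x)) (sym (to-from y)) x≤y))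
      (λ p → subst₂ L′._≤_ (to-from x) (to-from y) (Equivalence.to (emb _ _) p))
      where
      to-from : ∀ x → Inverse.to i (Inverse.from i x) ≡ x
      to-from = Inverse.strictlyInverseˡ i

  ⊴-resp-≅ : ∀ {ℓ} {𝓛 : Pred (LinearOrder a) ℓ} {L₁ L₂ L₁′ L₂′ : LinearOrder a} →
             L₁′ ≅ L₁ → L₂ ≅ L₂′ → L₁ ⊴[ 𝓛 ] L₂ → L₁′ ⊴[ 𝓛 ] L₂′
  ⊴-resp-≅ {L₁ = L₁} {L₂} {L₁′} {L₂′} (i , i-emb) (j , j-emb) (K , K∈𝓛 , P , f , f-emb , f-convex) =
    K , K∈𝓛 , P′ , j.to ∘ f ∘ i.to ,
    (λ x y → mk⇔ (J.mono ∘ F.mono ∘ I.mono) (I.reflect ∘ F.reflect ∘ J.reflect)) ,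
    convex
    where
    open ConvexPartition P
    module i = Inverse i
    module j = Inverse j
    module L₂′ = LinearOrder L₂′
    module I = Embedding L₁′ L₁ i-emb
    module F = Embedding L₁ L₂ f-emb
    module J = Embedding L₂ L₂′ j-emb

    i-back : ∀ {x k} → x ∈ part k → i.to (i.from x) ∈ part k
    i-back {x} {k} = subst (λ y → y ∈ part k) (sym (i.strictlyInverseˡ x))

    P′ : ConvexPartition K L₁′
    P′ = record
      { part     = λ k x → i.to x ∈ part k
      ; nonempty = λ k → let x , x∈k = nonempty k in i.from x , i-back x∈k
      ; covering = λ x → covering (i.to x)
      ; disjoint = disjoint
      ; ordered  = λ k k′ → mk⇔
          (λ k<k′ {x} {y} x∈k y∈k′ →
            I.<-reflect (Equivalence.to (ordered k k′) k<k′ {i.to x} {i.to y} x∈k y∈k′))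
          (λ less → Equivalence.from (ordered k k′) λ {x} {y} x∈k y∈k′ →
            subst₂ (LinearOrder._<_ L₁) (i.strictlyInverseˡ x) (i.strictlyInverseˡ y)
              (I.<-mono (less {i.from x} {i.from y} (i-back x∈k) (i-back y∈k′))))
      }

    convex : ∀ k → IsConvex L₂′ (Image (j.to ∘ f ∘ i.to) (λ x → i.to x ∈ part k))
    convex k {y = y} p q (x , x∈k , refl) (z , z∈k , refl) =
      let j-to-from = j.strictlyInverseˡ y
          w , w∈k , fw≡ = f-convex k
            (J.reflect (subst (j.to (f (i.to x)) L₂′.≤_) (sym j-to-from) p))
            (J.reflect (subst (L₂′._≤ j.to (f (i.to z))) (sym j-to-from) q))
            (_ , x∈k , refl) (_ , z∈k , refl)
      in i.from w , i-back w∈k ,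
         trans (cong j.to (trans (cong f (i.strictlyInverseˡ w)) fw≡)) j-to-from

  ----------------------------------------------------------------------
  -- A well-order with no convex copy in a given order

  -- For each x let W x be the set of all y not below x such that the interval
  -- from x to y in L₀ is well-ordered.  A well-order starting at x inside L₀ as a
  -- convex set is contained in W x, so any well-order longer than the sum of
  -- all W x, taken along a well-order of A, has no convex copy in L₀.
  module LongWellOrder {A : Set a} {_<ᵂ_ : Rel A a} (isSTO : IsStrictTotalOrder _≡_ _<ᵂ_)
                       (wf : WellFounded _<ᵂ_) (L₀ : LinearOrderOn A) (x₀ : A) where

    private
      module L₀ = Order (linearOrder L₀)

    ℕ-order : LinearOrder 0ℓ
    ℕ-order = linearOrder (record { isTotalOrder = ℕ.≤-isTotalOrder })

    A-order : LinearOrder a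
    A-order = linearOrder (record { isTotalOrder = ToNonStrict.isTotalOrder _≡_ _<ᵂ_ isSTO })

    -- The strict order of L₀, restricted to the elements from x upwards.
    Above : A → Rel A a
    Above x u v = x L₀.≤ u × u L₀.< v

    -- The triples (n , x , y) with y in W x.
    InW : ℕ × A × A → Set a
    InW (_ , x , y) = x L₀.≤ y × Acc (Above x) y

    inW? : ∀ t → Dec (InW t)
    inW? _ = em

    triples : LinearOrder a
    triples = lexOrder ℕ-order (lexOrder A-order (linearOrder L₀))

    -- Infinitely many copies, indexed by ℕ, of the sum of all W x.  A second
    -- copy bounds the first one, and as there is no last copy every element has
    -- an immediate successor.
    S : LinearOrder a
    S = subOrder triples inW?

    private
      module S = Order S
      module Outer = LexOrder ℕ-order (lexOrder A-order (linearOrder L₀))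
      module Inner = LexOrder A-order (linearOrder L₀)

    S-wellFounded : WellFounded S._<_
    S-wellFounded (t@(n , x , y) , p) =
      go (ℕ.<-wellFounded n) (wf x) (proj₂ (member inW? (t , p)))
      where
      Smaller : (t′ t : ℕ × A × A) → Set a
      Smaller (n′ , x′ , y′) (n , x , y) =
        n′ ℕ.< n ⊎ (n′ ≡ n × (x′ <ᵂ x ⊎ (x′ ≡ x × Above x y′ y)))

      <⇒Smaller : ∀ {u v} → u S.< v → Smaller (proj₁ u) (proj₁ v)
      <⇒Smaller {u} {v} u<v with Outer.lex-<⁻ (subOrder-< triples inW? {u} {v} u<v)
      ... | inj₁ (n′≤n , n′≢n) = inj₁ (ℕ.≤∧≢⇒< n′≤n n′≢n)
      ... | inj₂ (refl , lt) with Inner.lex-<⁻ lt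
      ...   | inj₁ (inj₁ x′<x , _)    = inj₂ (refl , inj₁ x′<x)
      ...   | inj₁ (inj₂ x′≡x , x′≢x) = ⊥-elim (x′≢x x′≡x)
      ...   | inj₂ (refl , y′<y)      = inj₂ (refl , inj₂ (refl , proj₁ (member inW? u) , y′<y))

      go : ∀ {n x y p} → Acc ℕ._<_ n → Acc _<ᵂ_ x → Acc (Above x) y → Acc S._<_ ((n , x , y) , p)
      descend : ∀ {n x y} → Acc ℕ._<_ n → Acc _<ᵂ_ x → Acc (Above x) y →
                ∀ u → Smaller (proj₁ u) (n , x , y) → Acc S._<_ u

      go {n} {x} {y} {p} aₙ aₓ aᵧ =
        acc λ {u} lt → descend aₙ aₓ aᵧ u (<⇒Smaller {u} {(n , x , y) , p} lt)

      descend (acc r) _ _ u (inj₁ n′<n)                           = go (r n′<n) (wf _) (proj₂ (member inW? u))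
      descend aₙ (acc r) _ u (inj₂ (refl , inj₁ x′<x))            = go aₙ (r x′<x) (proj₂ (member inW? u))
      descend aₙ aₓ (acc r) _ (inj₂ (refl , inj₂ (refl , above))) = go aₙ aₓ (r above)

    inS : ∀ t → InW t → S.Carrier
    inS = subset inW?

    S-< : ∀ {u v} → LinearOrder._<_ triples (proj₁ u) (proj₁ v) → u S.< v
    S-< (le , ne) = le , ne ∘ cong proj₁

    diagonal : ∀ n x → InW (n , x , x)
    diagonal n x = L₀.≤-refl , acc λ (x≤u , u<x) → ⊥-elim (L₀.<⇒≱ u<x x≤u)

    s₀ : S.Carrier
    s₀ = inS (0 , x₀ , x₀) (diagonal 0 x₀)

    next : ∀ s → ∃[ t ] s S.⋖ t
    next s@((n , x , y) , p) =
      let t , s<t , least = minimal S-wellFounded (s S.<_) {later}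
                              (S-< {s} {later} (Outer.lex-<₁ (ℕ.n≤1+n n , λ ())))
      in t , s<t , λ s<z z<t → least z<t s<z
      where
      later : S.Carrier
      later = inS (suc n , x , y) (member inW? s)

    -- Iterating g would give an infinite descending sequence.
    no-bound : ∀ {g} → Monotone S S g → ∀ b → ¬ (g b S.< b)
    no-bound {g} g-mono b = go (S-wellFounded b)
      where
      go : ∀ {b} → Acc S._<_ b → ¬ (g b S.< b)
      go (acc rs) gb<b = go (rs gb<b) (g-mono gb<b)

    -- A convex copy of S in L₀ with least element x lies in W x, hence maps into
    -- the copy number 0 of W x in S, which is bounded by the element top.
    S⋬L₀ : ¬ ConvexMap S (linearOrder L₀)
    S⋬L₀ h = no-bound {g} g-mono top (S-< {g top} {top} (Outer.lex-<₁ (ℕ.z≤n , λ ())))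
      where
      open ConvexMap h
      open Embedding S (linearOrder L₀) (Monotone⇒IsEmbedding S (linearOrder L₀) mono)
        using (<-reflect) renaming (mono to ≤-mono)

      least = minimal S-wellFounded (λ _ → Unit.⊤ {0ℓ}) {s₀} Unit.tt
      ⊥ₛ = proj₁ least

      ⊥ₛ≤ : ∀ s → ⊥ₛ S.≤ s
      ⊥ₛ≤ s = ¬¬-elim λ ⊥≰s → proj₂ (proj₂ least) (S.≰⇒> {⊥ₛ} {s} ⊥≰s) Unit.tt

      x = map ⊥ₛ

      accessible : ∀ s → Acc (Above x) (map s)
      accessible s = go (S-wellFounded s)
        where
        go : ∀ {s} → Acc S._<_ s → Acc (Above x) (map s)
        go {s} (acc rs) = acc λ (x≤u , u<s) →
          let t , t≡u = convex x≤u (proj₁ u<s) in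
          subst (Acc (Above x)) t≡u (go (rs (<-reflect (subst (L₀._< map s) (sym t≡u) u<s))))

      g : S.Carrier → S.Carrier
      g s = inS (0 , x , map s) (≤-mono {⊥ₛ} {s} (⊥ₛ≤ s) , accessible s)

      g-mono : Monotone S S g
      g-mono {s} {t} s<t = S-< {g s} {g t} (Outer.lex-<₂ (Inner.lex-<₂ (mono s<t)))

      top : S.Carrier
      top = inS (1 , x , x) (diagonal 1 x)

------------------------------------------------------------------------
-- The fractal property

theorem8p10 : Classical →
    ∀ {a ℓ} (κ : Cardinal a) → Infinite κ →
    (𝓛 : Pred (LinearOrder a) ℓ) →
    𝓛 ⊆ Scat κ → Satisfiable 𝓛 → DownwardClosed κ 𝓛 →
    Transitive (Restricted⊴ κ 𝓛) →
    (L₀ : LO κ) → EmbedsInto (Restricted⊴ κ 𝓛) (UpperCone⊴ κ 𝓛 L₀)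
theorem8p10 classical {a} κ e 𝓛 𝓛⊆Scat (K₁ , K₁∈𝓛) down _ L₀ =
  (λ L → φ L , L₀⊴φ L) , λ L L′ → mk⇔ (φ-mono L L′) (φ-reflect L L′)
  where
  open Cardinal κ
  open ClassicalSets classical
  open ClassicalOrders classical

  x₀ : Carrier
  x₀ = to e 0

  open LongWellOrder isStrictTotalOrder wellFounded L₀ x₀
  open Blocks (linearOrder L₀) S s₀ next S⋬L₀

  W : WellOrder a a
  W = record
    { Carrier     = Carrier
    ; _<_         = _<_
    ; compare     = IsStrictTotalOrder.compare isStrictTotalOrder
    ; <-trans     = IsStrictTotalOrder.trans isStrictTotalOrder
    ; wellFounded = wellFounded
    }

  pair : (Carrier × Carrier) ↣ Carrier
  pair = infinite-square W e

  sum : (Carrier ⊎ Carrier) ↣ Carrier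
  sum = pair ↣-∘ ⊎↣× λ x₀≡x₁ → ℕ.0≢1+n {0} (injective e x₀≡x₁)

  ℚ↣ : ℚ ↣ Carrier
  ℚ↣ = e ↣-∘ ℚ↣ℕ

  S↣ : LinearOrder.Carrier S ↣ Carrier
  S↣ = pair ↣-∘ ((e ×-↣ pair) ↣-∘ Subset↣ inW?)

  M↣ : LinearOrder.Carrier M ↣ Carrier
  M↣ = sum ↣-∘ ((pair ↣-∘ (ℚ↣ ×-↣ S↣)) ⊎-↣ (sum ↣-∘ (mk↣ id ⊎-↣ ℚ↣)))

  abstract
    bijection : Carrier ↔ (Carrier × LinearOrder.Carrier M)
    bijection = cantor-bernstein (mk↣ {to = λ x → x , inj₂ (inj₁ x₀)} (cong proj₁))
                                 (pair ↣-∘ (mk↣ id ×-↣ M↣))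

  -- The order inflate L, carried over to κ.
  φ : LO κ → LO κ
  φ L = record { isTotalOrder = pullback (inflate (linearOrder L)) (Inverse.to bijection)
                                  (injective (↔⇒↣ bijection)) }

  φ≅ : ∀ L → linearOrder (φ L) ≅ inflate (linearOrder L)
  φ≅ L = bijection , λ _ _ → mk⇔ id id

  ⊤-order : LinearOrder a
  ⊤-order = linearOrder {Carrier = Unit.⊤} record
    { _≤_ = λ _ _ → Unit.⊤
    ; isTotalOrder = record
      { isPartialOrder = record
        { isPreorder = record
          { isEquivalence = isEquivalence
          ; reflexive     = λ _ → Unit.tt
          ; trans         = λ _ _ → Unit.tt
          }
        ; antisym = λ _ _ → refl
        }
      ; total = λ _ _ → inj₁ Unit.tt
      }
    }

  down′ : ∀ {K₀ K} → LinearOrder.Carrier K₀ → K₀ ≼ K → K ∈ 𝓛 → K₀ ∈ 𝓛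
  down′ {K₀} {K} k₀ (f , f-emb) K∈𝓛 =
    down (k₀ , proj₂ (proj₁ (𝓛⊆Scat K∈𝓛)) ↣-∘ mk↣ (Embedding.inj K₀ K f-emb)) (f , f-emb) K∈𝓛

  ⊤-order∈𝓛 : ⊤-order ∈ 𝓛
  ⊤-order∈𝓛 = down′ Unit.tt
    ((λ _ → proj₁ (proj₁ (𝓛⊆Scat K₁∈𝓛))) ,
     λ _ _ → mk⇔ (λ _ → IsTotalOrder.refl (LinearOrder.isTotalOrder K₁)) (λ _ → Unit.tt)) K₁∈𝓛

  inflated : LO κ → LinearOrder a
  inflated L = inflate (linearOrder L)

  φ≅⁻ : ∀ L → inflated L ≅ linearOrder (φ L)
  φ≅⁻ L = ≅-sym (linearOrder (φ L)) (inflated L) (φ≅ L)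

  L₀⊴φ : ∀ L → Restricted⊴ κ 𝓛 L₀ (φ L)
  L₀⊴φ L =
    ⊴-resp-≅ {L₁ = linearOrder L₀} {inflated L} {linearOrder L₀} {linearOrder (φ L)}
      (↔-refl , λ _ _ → mk⇔ id id) (φ≅⁻ L)
      (L₀⊴inflate {K = ⊤-order} ⊤-order∈𝓛 Unit.tt (λ _ → refl) {linearOrder L} x₀ x₀)

  φ-mono : ∀ L L′ → Restricted⊴ κ 𝓛 L L′ → Restricted⊴ κ 𝓛 (φ L) (φ L′)
  φ-mono L L′ L⊴L′ =
    ⊴-resp-≅ {L₁ = inflated L} {inflated L′} {linearOrder (φ L)} {linearOrder (φ L′)}
      (φ≅ L) (φ≅⁻ L′)
      (inflate-mono 𝓛 {linearOrder L} {linearOrder L′} L⊴L′)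

  φ-reflect : ∀ L L′ → Restricted⊴ κ 𝓛 (φ L) (φ L′) → Restricted⊴ κ 𝓛 L L′
  φ-reflect L L′ φL⊴φL′ =
    deflate 𝓛 (λ K∈𝓛 → proj₂ (𝓛⊆Scat K∈𝓛)) (λ {K₀} {K} → down′ {K₀} {K})
      {linearOrder L} {linearOrder L′} x₀
      (⊴-resp-≅ {L₁ = linearOrder (φ L)} {linearOrder (φ L′)} {inflated L} {inflated L′}
        (φ≅⁻ L) (φ≅ L′) φL⊴φL′)
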